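{- Let $\lambda=p/q\in(0,1]$ be a reduced fraction (with $p,q$ positive integers) and suppose that either (i) $p\mid q+1$, or (ii) $q$ is odd and $2$ is the least positive integer $\ell$ for which $p\mid q+\ell$. Let $(b_n)_{n\geq 1}$ be the sequence obtained by applying the greedy underapproximation algorithm indefinitely to $p/q$. Then every sequence of integers $2\leq a_1<a_2<\cdots$ such that \[ \sum_{n=1}^{\infty}\frac1{a_n}=\frac pq,\qquad (a_n)_{n\geq 1}\neq(b_n)_{n\geq 1} \] satisfies \[ \liminf_{n\to\infty}a_n^{2^{ -n}}<\lim_{n\to\infty}b_n^{2^{ -n}} . \]
   Context: The greedy underapproximation algorithm applied to $\lambda\in(0,1]$ produces denominators recursively: $b_1$ is the smallest integer $x\geq 2$ with $1/x<\lambda$, and, given $b_1,\ldots,b_n$, the next denominator $b_{n+1}$ is the smallest integer $x>b_n$ for which $\sum_{i=1}^n 1/b_i+1/x<\lambda$. The limit $\lim_{n\to\infty}b_n^{2^{ -n}}$ exists and is finite and strictly positive. -}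

module Defs where

open import Algebra.Definitions.RawSemiring using () renaming (_^_ to pow)
open import Data.Integer using (+_)
open import Data.Nat as ℕ using (ℕ; zero; suc)
open import Data.Product using (_×_; _,_; ∃-syntax)
open import Data.Rational
open import Data.Rational.Properties
open import Data.Sum using (_⊎_; inj₁; inj₂)
open import Relation.Binary.Definitions using (tri<; tri≈; tri>)
open import Relation.Binary.PropositionalEquality using (_≡_; refl; sym; trans; cong; subst)
open import Relation.Nullary using (¬_; yes; no; contradiction)

infixr 8 _^_
_^_ : ℚ → ℕ → ℚ
_^_ = pow +-*-rawSemiring

-- A (classical) extended real number x is the set of the rationals r < x,
-- i.e. a downward closed set of rationals without greatest element. The empty
-- set is -∞ and the set of all rationals is +∞; the other ones are the
-- Dedekind cuts that form ℝ. Identifying these sets with extended reals uses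
-- classical logic.
record ℝ̄ : Set₁ where
  infix 4 _∋_
  field
    _∋_     : ℚ → Set
    down    : ∀ {r s} → r < s → _∋_ s → _∋_ r
    rounded : ∀ {r} → _∋_ r → ∃[ s ] r < s × _∋_ s

open ℝ̄ public using (_∋_)

infix 4 _<ᵣ_
_<ᵣ_ : ℝ̄ → ℝ̄ → Set
x <ᵣ y = ∃[ r ] y ∋ r × ¬ (x ∋ r)

infixl 6 _+ᵣ_
_+ᵣ_ : ℝ̄ → ℚ → ℝ̄
x +ᵣ ε = record
  { _∋_     = λ r → x ∋ r - ε
  ; down    = λ r<s → ℝ̄.down x (+-monoˡ-< (- ε) r<s)
  ; rounded = λ {r} x∋ → let s , r-ε<s , x∋s = ℝ̄.rounded x x∋ in
      s + ε
      , subst (_< s + ε) (cancel r (- ε) ε (+-inverseˡ ε)) (+-monoˡ-< ε r-ε<s)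
      , subst (x ∋_) (sym (cancel s ε (- ε) (+-inverseʳ ε))) x∋s
  }
  where
  cancel : ∀ a b c → b + c ≡ 0ℚ → a + b + c ≡ a
  cancel a b c eq = trans (+-assoc a b c) (trans (cong (_+_ a) eq) (+-identityʳ a))

sup : (ℕ → ℝ̄) → ℝ̄
sup x = record
  { _∋_     = λ r → ∃[ i ] x i ∋ r
  ; down    = λ r<s (i , x∋s) → i , ℝ̄.down (x i) r<s x∋s
  ; rounded = λ (i , x∋r) → let s , r<s , x∋s = ℝ̄.rounded (x i) x∋r in s , r<s , i , x∋s
  }

-- The intersection of the cuts need not be rounded, hence the margin r < s.
inf : (ℕ → ℝ̄) → ℝ̄
inf x = record
  { _∋_     = λ r → ∃[ s ] r < s × (∀ i → x i ∋ s)
  ; down    = λ r<r′ (s , r′<s , all) → s , <-trans r<r′ r′<s , all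
  ; rounded = λ (s , r<s , all) → let t , r<t , t<s = <-dense r<s in t , r<t , s , t<s , all
  }

liminf : (ℕ → ℝ̄) → ℝ̄
liminf x = sup λ N → inf λ k → x (N ℕ.+ k)

-- Convergence to a real number: |x n - L| < ε eventually, for every ε > 0.
-- L is automatically finite, as neither +∞ <ᵣ y nor x <ᵣ -∞ ever holds.
infix 4 _⟶_
_⟶_ : (ℕ → ℝ̄) → ℝ̄ → Set
x ⟶ L = ∀ ε → 0ℚ < ε → ∃[ N ] ∀ n → N ℕ.≤ n → (L <ᵣ x n +ᵣ ε) × (x n <ᵣ L +ᵣ ε)

^-nonNeg : ∀ m {r} → 0ℚ ≤ r → 0ℚ ≤ r ^ m
^-nonNeg zero    0≤r = nonNegative⁻¹ 1ℚ
^-nonNeg (suc m) {r} 0≤r = subst (_≤ r * r ^ m) (*-zeroʳ r)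
  (*-monoˡ-≤-nonNeg r {{nonNegative 0≤r}} (^-nonNeg m 0≤r))

^-mono : ∀ m {r s} → 0ℚ ≤ r → r ≤ s → r ^ m ≤ s ^ m
^-mono zero    _ _ = ≤-refl
^-mono (suc m) {r} {s} 0≤r r≤s = ≤-trans
  (*-monoʳ-≤-nonNeg (r ^ m) {{nonNegative (^-nonNeg m 0≤r)}} r≤s)
  (*-monoˡ-≤-nonNeg s {{nonNegative (≤-trans 0≤r r≤s)}} (^-mono m 0≤r r≤s))

enlarge : ∀ {x y t} → 0ℚ ≤ y → x * y < t → ∃[ x′ ] x < x′ × x′ * y < t
enlarge {x} {y} {t} 0≤y xy<t with <-cmp 0ℚ y
... | tri> _ _ y<0 = contradiction (<-≤-trans y<0 0≤y) (<-irrefl refl)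
... | tri≈ _ refl _ =
  x + 1ℚ
  , subst (_< x + 1ℚ) (+-identityʳ x) (+-monoʳ-< x (positive⁻¹ 1ℚ))
  , subst (_< t) (trans (*-zeroʳ x) (sym (*-zeroʳ (x + 1ℚ)))) xy<t
... | tri< 0<y _ _ =
  let x′ , x<x′ , x′<t/y = <-dense {x} {t * 1/ y} (*-cancelʳ-<-nonNeg y (subst (x * y <_) (sym t/y*y≡t) xy<t))
  in x′ , x<x′ , subst (x′ * y <_) t/y*y≡t (*-monoˡ-<-pos y x′<t/y)
  where
  instance
    y-pos : Positive y
    y-pos = positive 0<y
    y-nonZero : NonZero y
    y-nonZero = pos⇒nonZero y
    y-nonNeg : NonNegative y
    y-nonNeg = nonNegative 0≤y
  t/y*y≡t : t * 1/ y * y ≡ t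
  t/y*y≡t = trans (*-assoc t (1/ y) y) (trans (cong (t *_) (*-inverseˡ y)) (*-identityʳ t))

^-rounded : ∀ m {r t} → 0ℚ ≤ r → r ^ m < t → ∃[ s ] r < s × s ^ m < t
^-rounded zero    {r} 0≤r 1<t =
  r + 1ℚ , subst (_< r + 1ℚ) (+-identityʳ r) (+-monoʳ-< r (positive⁻¹ 1ℚ)) , 1<t
^-rounded (suc m) {r} {t} 0≤r rrᵐ<t =
  let x , r<x , xrᵐ<t = enlarge (^-nonNeg m 0≤r) rrᵐ<t
      0≤x             = ≤-trans 0≤r (<⇒≤ r<x)
      y , rᵐ<y , yx<t = enlarge 0≤x (subst (_< t) (*-comm x (r ^ m)) xrᵐ<t)
      s , r<s , sᵐ<y  = ^-rounded m 0≤r rᵐ<y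
      u , r<u , u≤x , u≤s = minimum r<x r<s
      0≤u             = ≤-trans 0≤r (<⇒≤ r<u)
  in u , r<u , ≤-<-trans
       (≤-trans
         (*-monoʳ-≤-nonNeg (u ^ m) {{nonNegative (^-nonNeg m 0≤u)}} u≤x)
         (*-monoˡ-≤-nonNeg x {{nonNegative 0≤x}}
           (≤-trans (^-mono m 0≤u u≤s) (<⇒≤ sᵐ<y))))
       (subst (_< t) (*-comm y x) yx<t)
  where
  minimum : ∀ {r x s} → r < x → r < s → ∃[ u ] r < u × u ≤ x × u ≤ s
  minimum {r} {x} {s} r<x r<s with ≤-total x s
  ... | inj₁ x≤s = x , r<x , ≤-refl , x≤s
  ... | inj₂ s≤x = s , r<s , s≤x , ≤-refl

-- r < a ^ (2 ^ -n) iff r < 0 or r ^ (2 ^ n) < a (for a > 0).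
_^2^-_ : ℕ → ℕ → ℝ̄
a ^2^- n = record { _∋_ = In ; down = λ {r} {s} → In-down {r} {s} ; rounded = λ {r} → In-rounded {r} }
  where
  In : ℚ → Set
  In r = r < 0ℚ ⊎ r ^ (2 ℕ.^ n) < + a / 1

  In-down : ∀ {r s} → r < s → In s → In r
  In-down r<s (inj₁ s<0) = inj₁ (<-trans r<s s<0)
  In-down {r} r<s (inj₂ sᵐ<a) with r <? 0ℚ
  ... | yes r<0 = inj₁ r<0
  ... | no  r≮0 = inj₂ (≤-<-trans (^-mono (2 ℕ.^ n) (≮⇒≥ r≮0) (<⇒≤ r<s)) sᵐ<a)

  In-rounded : ∀ {r} → In r → ∃[ s ] r < s × In s
  In-rounded (inj₁ r<0) = let s , r<s , s<0 = <-dense r<0 in s , r<s , inj₁ s<0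
  In-rounded {r} (inj₂ rᵐ<a) with r <? 0ℚ
  ... | yes r<0 = let s , r<s , s<0 = <-dense r<0 in s , r<s , inj₁ s<0
  ... | no  r≮0 = let s , r<s , sᵐ<a = ^-rounded (2 ℕ.^ n) (≮⇒≥ r≮0) rᵐ<a in s , r<s , inj₂ sᵐ<a

-- A sequence (aₙ)ₙ≥₁ is encoded as a : ℕ → ℕ with a n = aₙ₊₁, whence the
-- exponent 2 ^ -(n + 1).
roots : (ℕ → ℕ) → ℕ → ℝ̄
roots a n = a n ^2^- suc n

-- The value at 0 is never used: all denominators in question are ≥ 2.
unitFraction : ℕ → ℚ
unitFraction zero    = 0ℚ
unitFraction (suc k) = + 1 / suc k

partialSum : (ℕ → ℕ) → ℕ → ℚ
partialSum a zero    = 0ℚ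
partialSum a (suc n) = partialSum a n + unitFraction (a n)

HasSum : (ℕ → ℕ) → ℚ → Set
HasSum a s = ∀ ε → 0ℚ < ε → ∃[ N ] ∀ n → N ℕ.≤ n → ∣ partialSum a n - s ∣ < ε

IsLeast : (ℕ → Set) → ℕ → Set
IsLeast P m = P m × (∀ k → P k → m ℕ.≤ k)

record IsGreedy (lam : ℚ) (b : ℕ → ℕ) : Set where
  field
    first : IsLeast (λ x → 2 ℕ.≤ x × unitFraction x < lam) (b 0)
    next  : ∀ n → IsLeast (λ x → b n ℕ.< x × partialSum b (suc n) + unitFraction x < lam) (b (suc n))

-- Let the remainder of a series after n terms be what is missing to
-- p / q. From the third term on, the greedy remainders are reciprocals 1 / D of
-- integers, with next denominator D + 1, so bₙ^(2^-n) decreases and D^(2^-n)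
-- increases to the limit L.
--
-- If a first differs from b at the index k, then aₖ ≥ bₖ + 1. We compare the
-- tail of a with that of a series with real denominators βₖ = bₖ + 1/2, βₖ₊₁, …
-- chosen such that from k + 2 terms on the remainder is the reciprocal of
-- q₀ βₖ βₖ₊₁ ⋯, where p₀ / q₀ is the remainder at k. If the remainder of a ever
-- fell below that of β, Abel summation would give Σ aᵢ / βᵢ ≤ n over the n terms
-- from k on, hence ∏ aᵢ ≤ ∏ βᵢ by AM-GM; but the remainder of a is a positive
-- integer divided by q₀ ∏ aᵢ, so it is at least 1 / (q₀ ∏ βᵢ), the remainder
-- of β. So the remainders of a are at least 1 / W, where W satisfies the same
-- recursion W ↦ W (W + 1) as D but starts at a smaller value. Hence W grows like
-- c^(2^n) for some c < L, whereas a sequence with aₙ ≥ s^(2^n) eventually has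
-- remainders below 1 / (s^(2^(n+1)) - 1).

module Submission where

open import Defs

module Lemmas where

  open import Axiom.ExcludedMiddle using (ExcludedMiddle)
  import Data.Integer as ℤ
  import Data.Integer.Properties as ℤ
  open import Data.Maybe using (Maybe; just; nothing)
  open import Data.Nat as ℕ using (ℕ; zero; suc)
  import Data.Nat.Divisibility as ℕ
  import Data.Nat.Properties as ℕ
  open import Data.Nat.Tactic.RingSolver using () renaming (solve-∀ to ℕ-solve-∀)
  open import Data.Product using (_×_; _,_; proj₁; proj₂; ∃-syntax)
  open import Data.Rational
  open import Data.Rational.Properties
  open import Data.Rational.Unnormalised using (mkℚᵘ; *≡*; *≤*) renaming (_≃_ to _≃ᵘ_)
  import Data.Rational.Unnormalised.Properties as ℚᵘ
  open import Data.Sum using (_⊎_; inj₁; inj₂; [_,_]′)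
  open import Level using (0ℓ)
  open import Relation.Binary.PropositionalEquality
  open import Relation.Nullary using (¬_; Dec; yes; no; contradiction)
  open import Tactic.RingSolver using (solve-∀)
  open import Tactic.RingSolver.Core.AlmostCommutativeRing using (AlmostCommutativeRing; fromCommutativeRing)

  -- Ordered field arithmetic of ℚ

  ring : AlmostCommutativeRing _ _
  ring = fromCommutativeRing +-*-commutativeRing zero?
    where
    zero? : ∀ x → Maybe (0ℚ ≡ x)
    zero? x with 0ℚ ≟ x
    ... | yes e = just e
    ... | no  _ = nothing

  ≤⇒0≤ : ∀ {x y} → x ≤ y → 0ℚ ≤ y - x
  ≤⇒0≤ {x} {y} x≤y = subst (_≤ y - x) (+-inverseʳ x) (+-monoˡ-≤ (- x) x≤y)

  <⇒0< : ∀ {x y} → x < y → 0ℚ < y - x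
  <⇒0< {x} {y} x<y = subst (_< y - x) (+-inverseʳ x) (+-monoˡ-< (- x) x<y)

  add-difference : ∀ x y → x + (y - x) ≡ y
  add-difference = solve-∀ ring

  -- Most inequalities x ≤ y below are proved by a ring identity that writes y - x
  -- as an expression of visible sign.
  by-≤ : ∀ {x y t} → 0ℚ ≤ t → y - x ≡ t → x ≤ y
  by-≤ {x} {y} 0≤t refl = subst₂ _≤_ (+-identityʳ x) (add-difference x y) (+-monoʳ-≤ x 0≤t)

  by-< : ∀ {x y t} → 0ℚ < t → y - x ≡ t → x < y
  by-< {x} {y} 0<t refl = subst₂ _<_ (+-identityʳ x) (add-difference x y) (+-monoʳ-< x 0<t)

  0≤+ : ∀ {x y} → 0ℚ ≤ x → 0ℚ ≤ y → 0ℚ ≤ x + y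
  0≤+ = +-mono-≤

  0<+ : ∀ {x y} → 0ℚ < x → 0ℚ ≤ y → 0ℚ < x + y
  0<+ = +-mono-<-≤

  0≤* : ∀ {x y} → 0ℚ ≤ x → 0ℚ ≤ y → 0ℚ ≤ x * y
  0≤* {x} {y} 0≤x 0≤y = nonNegative⁻¹ (x * y)
    {{nonNeg*nonNeg⇒nonNeg x {{nonNegative 0≤x}} y {{nonNegative 0≤y}}}}

  0<* : ∀ {x y} → 0ℚ < x → 0ℚ < y → 0ℚ < x * y
  0<* {x} {y} 0<x 0<y = positive⁻¹ (x * y) {{pos*pos⇒pos x {{positive 0<x}} y {{positive 0<y}}}}

  *-monoˡ : ∀ {x y z} → 0ℚ ≤ z → x ≤ y → z * x ≤ z * y
  *-monoˡ {z = z} 0≤z = *-monoˡ-≤-nonNeg z {{nonNegative 0≤z}}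

  *-monoʳ : ∀ {x y z} → 0ℚ ≤ z → x ≤ y → x * z ≤ y * z
  *-monoʳ {z = z} 0≤z = *-monoʳ-≤-nonNeg z {{nonNegative 0≤z}}

  *-mono : ∀ {w x y z} → 0ℚ ≤ w → 0ℚ ≤ y → w ≤ x → y ≤ z → w * y ≤ x * z
  *-mono 0≤w 0≤y w≤x y≤z = ≤-trans (*-monoʳ 0≤y w≤x) (*-monoˡ (≤-trans 0≤w w≤x) y≤z)

  cancelˡ-≤ : ∀ {x y} z → 0ℚ < z → z * x ≤ z * y → x ≤ y
  cancelˡ-≤ z 0<z = *-cancelˡ-≤-pos z {{positive 0<z}}

  cancelˡ-< : ∀ {x y} z → 0ℚ < z → z * x < z * y → x < y
  cancelˡ-< z 0<z = *-cancelˡ-<-nonNeg z {{nonNegative (<⇒≤ 0<z)}}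

  opaque
    inverse : ∀ x → 0ℚ < x → ∃[ y ] (0ℚ < y × x * y ≡ 1ℚ)
    inverse x 0<x = 1/ x , positive⁻¹ (1/ x) {{1/pos⇒pos x}} , *-inverseʳ x
      where instance
      x-pos : Positive x
      x-pos = positive 0<x
      x-nonZero : NonZero x
      x-nonZero = pos⇒nonZero x

  0<1 : 0ℚ < 1ℚ
  0<1 = positive⁻¹ 1ℚ

  0≤1 : 0ℚ ≤ 1ℚ
  0≤1 = <⇒≤ 0<1

  -- Natural numbers in ℚ

  opaque
    ι : ℕ → ℚ
    ι n = ℤ.+ n / 1

    ι≡/1 : ∀ n → ι n ≡ ℤ.+ n / 1
    ι≡/1 n = refl

  toℚᵘ-ι : ∀ n → toℚᵘ (ι n) ≃ᵘ mkℚᵘ (ℤ.+ n) 0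
  toℚᵘ-ι n = subst (λ x → toℚᵘ x ≃ᵘ mkℚᵘ (ℤ.+ n) 0) (sym (ι≡/1 n)) (toℚᵘ-fromℚᵘ (mkℚᵘ (ℤ.+ n) 0))

  ι0≡0 : ι 0 ≡ 0ℚ
  ι0≡0 = ι≡/1 0

  ι1≡1 : ι 1 ≡ 1ℚ
  ι1≡1 = ι≡/1 1

  ι-+ : ∀ m n → ι (m ℕ.+ n) ≡ ι m + ι n
  ι-+ m n = toℚᵘ-injective (ℚᵘ.≃-trans (toℚᵘ-ι (m ℕ.+ n)) (ℚᵘ.≃-sym (ℚᵘ.≃-trans (toℚᵘ-homo-+ (ι m) (ι n))
    (ℚᵘ.≃-trans (ℚᵘ.+-cong (toℚᵘ-ι m) (toℚᵘ-ι n))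
      (*≡* (cong (ℤ._* ℤ.+ 1) (cong₂ ℤ._+_ (ℤ.*-identityʳ (ℤ.+ m)) (ℤ.*-identityʳ (ℤ.+ n)))))))))

  ι-* : ∀ m n → ι (m ℕ.* n) ≡ ι m * ι n
  ι-* m n = toℚᵘ-injective (ℚᵘ.≃-trans (toℚᵘ-ι (m ℕ.* n)) (ℚᵘ.≃-sym (ℚᵘ.≃-trans (toℚᵘ-homo-* (ι m) (ι n))
    (ℚᵘ.≃-trans (ℚᵘ.*-cong (toℚᵘ-ι m) (toℚᵘ-ι n))
      (*≡* (cong (ℤ._* ℤ.+ 1) (sym (ℤ.pos-* m n))))))))

  /-* : ∀ m n .{{_ : ℕ.NonZero n}} → (ℤ.+ m / n) * ι n ≡ ι m
  /-* m n@(suc k) = toℚᵘ-injective (ℚᵘ.≃-trans (toℚᵘ-homo-* (ℤ.+ m / n) (ι n))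
    (ℚᵘ.≃-trans (ℚᵘ.*-cong (toℚᵘ-fromℚᵘ (mkℚᵘ (ℤ.+ m) k)) (toℚᵘ-ι n))
      (ℚᵘ.≃-trans (*≡* (trans (ℤ.*-identityʳ _) (cong (λ x → ℤ.+ m ℤ.* ℤ.+ x) (sym (ℕ.*-identityʳ n)))))
        (ℚᵘ.≃-sym (toℚᵘ-ι m)))))

  ι-suc : ∀ n → ι (suc n) ≡ 1ℚ + ι n
  ι-suc n = trans (ι-+ 1 n) (cong (_+ ι n) ι1≡1)

  ι-suc′ : ∀ n → ι (suc n) ≡ ι n + 1ℚ
  ι-suc′ n = trans (ι-suc n) (+-comm 1ℚ (ι n))

  0≤ι : ∀ n → 0ℚ ≤ ι n
  0≤ι zero    = ≤-reflexive (sym ι0≡0)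
  0≤ι (suc n) = subst (0ℚ ≤_) (sym (ι-suc n)) (0≤+ 0≤1 (0≤ι n))

  ι-∸ : ∀ {m n} → n ℕ.≤ m → ι m - ι n ≡ ι (m ℕ.∸ n)
  ι-∸ {m} {n} n≤m = trans (cong (λ k → ι k - ι n) (sym (ℕ.m+[n∸m]≡n n≤m)))
    (trans (cong (_- ι n) (ι-+ n (m ℕ.∸ n))) (cancel (ι n) (ι (m ℕ.∸ n))))
    where
    cancel : ∀ x y → x + y - x ≡ y
    cancel = solve-∀ ring

  ι-mono-≤ : ∀ {m n} → m ℕ.≤ n → ι m ≤ ι n
  ι-mono-≤ {m} {n} m≤n = by-≤ (0≤ι (n ℕ.∸ m)) (ι-∸ m≤n)

  ι-mono-< : ∀ {m n} → m ℕ.< n → ι m < ι n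
  ι-mono-< {m} m<n = <-≤-trans (by-< 0<1 (trans (cong (_- ι m) (ι-suc m)) (cancel (ι m)))) (ι-mono-≤ m<n)
    where
    cancel : ∀ x → 1ℚ + x - x ≡ 1ℚ
    cancel = solve-∀ ring

  0<ι : ∀ {n} → 0 ℕ.< n → 0ℚ < ι n
  0<ι {n} 0<n = subst (_< ι n) ι0≡0 (ι-mono-< 0<n)

  1<ι : ∀ {n} → 1 ℕ.< n → 1ℚ < ι n
  1<ι {n} 1<n = subst (_< ι n) ι1≡1 (ι-mono-< 1<n)

  ι-cancel-< : ∀ {m n} → ι m < ι n → m ℕ.< n
  ι-cancel-< ιm<ιn = ℕ.≰⇒> λ n≤m → <-irrefl refl (<-≤-trans ιm<ιn (ι-mono-≤ n≤m))

  0<ι⇒1≤ι : ∀ {n} → 0ℚ < ι n → 1ℚ ≤ ι n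
  0<ι⇒1≤ι {n} 0<ιn = subst (_≤ ι n) ι1≡1 (ι-mono-≤ (ι-cancel-< (subst (_< ι n) (sym ι0≡0) 0<ιn)))

  ι-cancel-≤ : ∀ {m n} → ι m ≤ ι n → m ℕ.≤ n
  ι-cancel-≤ ιm≤ιn = ℕ.≮⇒≥ λ n<m → <-irrefl refl (<-≤-trans (ι-mono-< n<m) ιm≤ιn)

  unitFraction-* : ∀ {n} → 0 ℕ.< n → unitFraction n * ι n ≡ 1ℚ
  unitFraction-* {suc k} _ = trans (/-* 1 (suc k)) ι1≡1

  opaque
    archimedean : ∀ x → ∃[ n ] x < ι n
    archimedean x = suc ℤ.∣ ↥ x ∣ , ≤-<-trans (x≤∣↥x∣ x) (ι-mono-< (ℕ.n<1+n ℤ.∣ ↥ x ∣))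
      where
      x≤∣↥x∣ : ∀ x → x ≤ ι ℤ.∣ ↥ x ∣
      x≤∣↥x∣ x@(mkℚ (ℤ.+ m) d _) = toℚᵘ-cancel-≤ (ℚᵘ.≤-respʳ-≃ (ℚᵘ.≃-sym (toℚᵘ-ι m))
        (*≤* (subst₂ ℤ._≤_ (ℤ.pos-* m 1) (ℤ.pos-* m (suc d)) (ℤ.+≤+ (ℕ.*-monoʳ-≤ m ℕ.z<s)))))
      x≤∣↥x∣ x@(mkℚ ℤ.-[1+ m ] d _) = toℚᵘ-cancel-≤ (ℚᵘ.≤-respʳ-≃ (ℚᵘ.≃-sym (toℚᵘ-ι (suc m))) (*≤* ℤ.-≤+))

  cancelˡ-≡ : ∀ {x y} z → 0ℚ < z → z * x ≡ z * y → x ≡ y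
  cancelˡ-≡ z 0<z e = ≤-antisym (cancelˡ-≤ z 0<z (≤-reflexive e)) (cancelˡ-≤ z 0<z (≤-reflexive (sym e)))

  0<-factor : ∀ {x} z → 0ℚ < z → 0ℚ < z * x → 0ℚ < x
  0<-factor {x} z 0<z 0<zx = cancelˡ-< z 0<z (subst (_< z * x) (sym (*-zeroʳ z)) 0<zx)

  -- Powers and the AM-GM inequality

  ^-+ : ∀ r m n → r ^ (m ℕ.+ n) ≡ r ^ m * r ^ n
  ^-+ r zero    n = sym (*-identityˡ (r ^ n))
  ^-+ r (suc m) n = trans (cong (r *_) (^-+ r m n)) (sym (*-assoc r (r ^ m) (r ^ n)))

  ^-*-distrib : ∀ r s m → (r * s) ^ m ≡ r ^ m * s ^ m
  ^-*-distrib r s zero    = refl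
  ^-*-distrib r s (suc m) = trans (cong (r * s *_) (^-*-distrib r s m)) (swap r s (r ^ m) (s ^ m))
    where
    swap : ∀ a b c d → a * b * (c * d) ≡ a * c * (b * d)
    swap = solve-∀ ring

  ^2^-suc : ∀ r n → r ^ (2 ℕ.^ suc n) ≡ r ^ (2 ℕ.^ n) * r ^ (2 ℕ.^ n)
  ^2^-suc r n = trans (cong (λ k → r ^ (2 ℕ.^ n ℕ.+ k)) (ℕ.+-identityʳ (2 ℕ.^ n))) (^-+ r (2 ℕ.^ n) (2 ℕ.^ n))

  1^ : ∀ m → 1ℚ ^ m ≡ 1ℚ
  1^ zero    = refl
  1^ (suc m) = trans (*-identityˡ (1ℚ ^ m)) (1^ m)

  1≤^ : ∀ m {r} → 1ℚ ≤ r → 1ℚ ≤ r ^ m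
  1≤^ m {r} 1≤r = subst (_≤ r ^ m) (1^ m) (^-mono m 0≤1 1≤r)

  -- Bernoulli's inequality at a base `y` that is at least 1. The induction step gains
  -- `δ * (y ^ m - 1)`, `m * δ * (y - 1)` and `m * δ * δ`, all nonnegative for such `y`.
  bernoulli : ∀ m {y δ} → 1ℚ ≤ y → 0ℚ ≤ δ → y ^ m + ι m * δ ≤ (y + δ) ^ m
  bernoulli zero    {y} {δ} 1≤y 0≤δ = ≤-reflexive
    (trans (cong (λ k → 1ℚ + k * δ) ι0≡0) (trans (cong (1ℚ +_) (*-zeroˡ δ)) (+-identityʳ 1ℚ)))
  bernoulli (suc m) {y} {δ} 1≤y 0≤δ = ≤-trans
    (by-≤ (0≤+ (0≤* 0≤δ (≤⇒0≤ (1≤^ m 1≤y)))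
        (0≤+ (0≤* (0≤* (0≤ι m) 0≤δ) (≤⇒0≤ 1≤y)) (0≤* 0≤δ (0≤* (0≤ι m) 0≤δ))))
      (trans (cong (λ k → (y + δ) * (y ^ m + ι m * δ) - (y * y ^ m + k * δ)) (ι-suc m)) (expand y δ (y ^ m) (ι m))))
    (*-monoˡ (0≤+ (≤-trans 0≤1 1≤y) 0≤δ) (bernoulli m 1≤y 0≤δ))
    where
    expand : ∀ y δ p k → (y + δ) * (p + k * δ) - (y * p + (1ℚ + k) * δ)
      ≡ δ * (p - 1ℚ) + (k * δ * (y - 1ℚ) + δ * (k * δ))
    expand = solve-∀ ring

  -- Convexity: the left side is the value at `g` of the tangent to `x ^ suc m` at `s`. In the
  -- induction step the surplus is a nonnegative multiple of the square of `g - s`.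
  tangent : ∀ m {g s} → 0ℚ ≤ g → 0ℚ ≤ s → s ^ m * (ι (suc m) * g - ι m * s) ≤ g ^ suc m
  tangent zero    {g} {s} 0≤g 0≤s = ≤-reflexive
    (trans (cong₂ (λ j k → 1ℚ * (j * g - k * s)) ι1≡1 ι0≡0) (simplify g s))
    where
    simplify : ∀ g s → 1ℚ * (1ℚ * g - 0ℚ * s) ≡ g * 1ℚ
    simplify = solve-∀ ring
  tangent (suc m) {g} {s} 0≤g 0≤s = ≤-trans
    (by-≤ (0≤* (0≤* (^-nonNeg m 0≤s) (0≤ι (suc m))) (square (g - s)))
      (trans (cong₂ (λ k l → g * (s ^ m * (ι (suc m) * g - k * s)) - s * s ^ m * (l * g - ι (suc m) * s))
        (shift (ι m) (ι (suc m)) (ι-suc m)) (ι-suc (suc m)))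
        (expand g s (s ^ m) (ι (suc m)))))
    (*-monoˡ 0≤g (tangent m 0≤g 0≤s))
    where
    shift : ∀ a b → b ≡ 1ℚ + a → a ≡ b - 1ℚ
    shift a _ refl = identity a
      where
      identity : ∀ a → a ≡ 1ℚ + a - 1ℚ
      identity = solve-∀ ring
    square : ∀ x → 0ℚ ≤ x * x
    square x with ≤-total 0ℚ x
    ... | inj₁ 0≤x = 0≤* 0≤x 0≤x
    ... | inj₂ x≤0 = subst (0ℚ ≤_) (neg² x) (0≤* (neg-antimono-≤ x≤0) (neg-antimono-≤ x≤0))
      where
      neg² : ∀ x → (- x) * (- x) ≡ x * x
      neg² = solve-∀ ring
    expand : ∀ g s p k → g * (p * (k * g - (k - 1ℚ) * s)) - s * p * ((1ℚ + k) * g - k * s)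
      ≡ p * k * ((g - s) * (g - s))
    expand = solve-∀ ring

  ∑ : (ℕ → ℚ) → ℕ → ℚ
  ∑ u zero    = 0ℚ
  ∑ u (suc n) = ∑ u n + u n

  ∏ : (ℕ → ℚ) → ℕ → ℚ
  ∏ u zero    = 1ℚ
  ∏ u (suc n) = ∏ u n * u n

  ∑-nonNeg : ∀ u → (∀ i → 0ℚ ≤ u i) → ∀ n → 0ℚ ≤ ∑ u n
  ∑-nonNeg u 0≤u zero    = ≤-refl
  ∑-nonNeg u 0≤u (suc n) = 0≤+ (∑-nonNeg u 0≤u n) (0≤u n)

  -- Induction through the mean `s` of the first `n` numbers: their product is at most `s ^ n`, the
  -- bound on the sum caps `u n` by `ι (suc n) * g - ι n * s`, and `tangent` bounds the product of
  -- these two.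
  am-gm : ∀ u → (∀ i → 0ℚ ≤ u i) → ∀ n g → 0ℚ ≤ g → ∑ u n ≤ ι n * g → ∏ u n ≤ g ^ n
  am-gm u 0≤u zero    g 0≤g _   = ≤-refl
  am-gm u 0≤u (suc n) g 0≤g ∑≤ = begin
    ∏ u n * u n                           ≤⟨ *-monoʳ (0≤u n) (am-gm u 0≤u n s 0≤s (≤-reflexive (sym (mean n)))) ⟩
    s ^ n * u n                           ≤⟨ *-monoˡ (^-nonNeg n 0≤s) uₙ≤ ⟩
    s ^ n * (ι (suc n) * g - ι n * s)     ≤⟨ tangent n 0≤g 0≤s ⟩
    g ^ suc n                             ∎
    where
    open ≤-Reasoning
    -- For `n = 0` this is 0, as `unitFraction 0` is 0, so `mean` holds there too.
    average : ℕ → ℚ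
    average n = ∑ u n * unitFraction n
    s = average n
    0≤unitFraction : ∀ n → 0ℚ ≤ unitFraction n
    0≤unitFraction zero    = ≤-refl
    0≤unitFraction (suc k) = nonNegative⁻¹ (unitFraction (suc k)) {{normalize-nonNeg 1 (suc k)}}
    0≤s : 0ℚ ≤ s
    0≤s = 0≤* (∑-nonNeg u 0≤u n) (0≤unitFraction n)
    mean : ∀ n → ι n * average n ≡ ∑ u n
    mean zero    = *-zeroʳ (ι 0)
    mean (suc k) = trans (rotate (ι (suc k)) (∑ u (suc k)) (unitFraction (suc k)))
      (trans (cong (∑ u (suc k) *_) (unitFraction-* {suc k} ℕ.z<s)) (*-identityʳ _))
      where
      rotate : ∀ a b c → a * (b * c) ≡ b * (c * a)
      rotate = solve-∀ ring
    uₙ≤ : u n ≤ ι (suc n) * g - ι n * s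
    uₙ≤ = by-≤ (≤⇒0≤ ∑≤) (trans
      (cong (λ z → ι (suc n) * g - z - u n) (mean n)) (regroup (ι (suc n) * g) (∑ u n) (u n)))
      where
      regroup : ∀ a b c → a - b - c ≡ a - (b + c)
      regroup = solve-∀ ring

  -- Comparison of remainders

  -- By Abel summation ∑ u n ≤ n + α (n - 1) * (ρ n - σ n) as long as σ ≤ ρ before
  -- n. If this fails at n, then the factors u have mean at most 1, hence product
  -- at most 1 by AM-GM.
  majorization :
    (α ρ σ : ℕ → ℚ) →
    (∀ n → 0ℚ ≤ α n) → (∀ n → α n ≤ α (suc n)) →
    (∀ n → α n * (ρ n - ρ (suc n)) ≡ 1ℚ) →
    (∀ n → 0ℚ ≤ σ n - σ (suc n)) →
    (∀ n → ∏ (λ i → α i * (σ i - σ (suc i))) n ≤ 1ℚ → σ n ≤ ρ n) →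
    ∀ n → σ n ≤ ρ n
  majorization α ρ σ 0≤α α-mono ρ-step σ-step criterion n = proj₁ (invariant n)
    where
    u : ℕ → ℚ
    u i = α i * (σ i - σ (suc i))

    0≤u : ∀ i → 0ℚ ≤ u i
    0≤u i = 0≤* (0≤α i) (σ-step i)

    expand : ∀ n a r r′ s s′ → 1ℚ + n + a * (r′ - s′) - (n + a * (r - s) + a * (s - s′)) ≡ 1ℚ - a * (r - r′)
    expand = solve-∀ ring

    abel : ∀ n → ∑ u n ≤ ι n + α n * (ρ n - σ n) → ∑ u (suc n) ≤ ι (suc n) + α n * (ρ (suc n) - σ (suc n))
    abel n ∑≤ = ≤-trans (+-monoˡ-≤ (u n) ∑≤) (by-≤ ≤-refl
      (trans (cong (λ k → k + α n * (ρ (suc n) - σ (suc n)) - (ι n + α n * (ρ n - σ n) + u n)) (ι-suc n))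
      (trans (expand (ι n) (α n) (ρ n) (ρ (suc n)) (σ n) (σ (suc n)))
      (cong (λ y → 1ℚ - y) (ρ-step n)))))

    invariant : ∀ n → σ n ≤ ρ n × ∑ u n ≤ ι n + α n * (ρ n - σ n)
    invariant zero = σ₀≤ρ₀ , 0≤+ (0≤ι 0) (0≤* (0≤α 0) (≤⇒0≤ σ₀≤ρ₀))
      where
      σ₀≤ρ₀ = criterion 0 ≤-refl
    -- The coefficient `α n` that `abel` leaves may be raised to `α (suc n)` because `ρ - σ` is
    -- nonnegative at `suc n`.
    invariant (suc n) = σ≤ρ , ≤-trans ∑≤ (+-monoʳ-≤ (ι (suc n)) (*-monoʳ (≤⇒0≤ σ≤ρ) (α-mono n)))
      where
      ∑≤ = abel n (proj₂ (invariant n))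

      negative-product : ∀ a r s → - (a * (r - s)) ≡ a * (s - r)
      negative-product = solve-∀ ring

      cancel : ∀ k x → k * 1ℚ - (k + x) ≡ - x
      cancel = solve-∀ ring

      σ≤ρ : σ (suc n) ≤ ρ (suc n)
      σ≤ρ with ≤-total (σ (suc n)) (ρ (suc n))
      ... | inj₁ le = le
      ... | inj₂ ρ≤σ = criterion (suc n) (subst (∏ u (suc n) ≤_) (1^ (suc n))
        (am-gm u 0≤u (suc n) 1ℚ 0≤1 (≤-trans ∑≤
          (by-≤ (0≤* (0≤α n) (≤⇒0≤ ρ≤σ))
            (trans (cancel (ι (suc n)) (α n * (ρ (suc n) - σ (suc n))))
                   (negative-product (α n) (ρ (suc n)) (σ (suc n))))))))

  -- The reciprocals of the remainders when each denominator is one more than the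
  -- reciprocal of the previous remainder.
  sylvester : ℚ → ℕ → ℚ
  sylvester w zero    = w
  sylvester w (suc n) = sylvester w n * (sylvester w n + 1ℚ)

  sylvester-pos : ∀ {w} → 0ℚ < w → ∀ n → 0ℚ < sylvester w n
  sylvester-pos 0<w zero    = 0<w
  sylvester-pos 0<w (suc n) = let 0<wₙ = sylvester-pos 0<w n in 0<* 0<wₙ (0<+ 0<wₙ 0≤1)

  ½≥0 : 0ℚ ≤ ½
  ½≥0 = nonNegative⁻¹ ½

  -- The comparison series has the denominators β₀ = B + 1/2, then β₁ chosen such
  -- that the remainder w 0 becomes the reciprocal of W₀ = q * β₀ * β₁, and then
  -- βₙ₊₂ = W n + 1, which preserves this relation. The least competing denominator
  -- B + 1 would not do for β₀: if q = 1 it merely swaps the first two denominators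
  -- 2 and 3 of the Sylvester series.
  module Tail
    (α ρ : ℕ → ℚ) (p q l B : ℚ)
    (0<p : 0ℚ < p) (0<q : 0ℚ < q) (0<l : 0ℚ < l) (0<B : 0ℚ < B)
    (α-mono : ∀ n → α n ≤ α (suc n))
    (ρ-step : ∀ n → α n * (ρ n - ρ (suc n)) ≡ 1ℚ)
    (ρ₀ : q * ρ 0 ≡ p)
    (integral : ∀ n → 1ℚ ≤ q * ∏ α n * ρ n)
    (pB≡q+l : p * B ≡ q + l)
    (B+1≤α₀ : B + 1ℚ ≤ α 0)
    (small-l : l * (B + B + 1ℚ) < q * B + q * B + (1ℚ + 1ℚ))
    where

    β₀ = B + ½
    0<β₀ : 0ℚ < β₀
    0<β₀ = 0<+ 0<B ½≥0

    x₀ = proj₁ (inverse β₀ 0<β₀)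
    β₀x₀≡1 = proj₂ (proj₂ (inverse β₀ 0<β₀))

    -- `P₁ / Q₁` is what remains of `p / q` after `1 / β₀`: its numerator is `p * (B + ½) - q`,
    -- where `p * B = q + l`.
    P₁ = l + ½ * p
    0<P₁ : 0ℚ < P₁
    0<P₁ = 0<+ 0<l (0≤* ½≥0 (<⇒≤ 0<p))

    Q₁ = q * β₀
    0<Q₁ : 0ℚ < Q₁
    0<Q₁ = 0<* 0<q 0<β₀

    P₁⁻¹ = proj₁ (inverse P₁ 0<P₁)
    P₁P₁⁻¹≡1 = proj₂ (proj₂ (inverse P₁ 0<P₁))

    -- Subtracting `1 / β₁` from `P₁ / Q₁` leaves `P₁ / (Q₁ * (Q₁ + 1))`, the reciprocal of
    -- `Q₁ * β₁`.
    β₁ = (Q₁ + 1ℚ) * P₁⁻¹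
    0<β₁ : 0ℚ < β₁
    0<β₁ = 0<* (0<+ 0<Q₁ 0≤1) (proj₁ (proj₂ (inverse P₁ 0<P₁)))

    P₁β₁≡Q₁+1 : P₁ * β₁ ≡ Q₁ + 1ℚ
    P₁β₁≡Q₁+1 = trans (swap P₁ (Q₁ + 1ℚ) P₁⁻¹)
      (trans (cong ((Q₁ + 1ℚ) *_) P₁P₁⁻¹≡1) (*-identityʳ (Q₁ + 1ℚ)))
      where
      swap : ∀ a b c → a * (b * c) ≡ b * (a * c)
      swap = solve-∀ ring

    W₀ = Q₁ * β₁
    0<W₀ : 0ℚ < W₀
    0<W₀ = 0<* 0<Q₁ 0<β₁

    W : ℕ → ℚ
    W = sylvester W₀

    0<W : ∀ n → 0ℚ < W n
    0<W = sylvester-pos 0<W₀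

    w : ℕ → ℚ
    w n = proj₁ (inverse (W n) (0<W n))

    0<w : ∀ n → 0ℚ < w n
    0<w n = proj₁ (proj₂ (inverse (W n) (0<W n)))

    Ww≡1 : ∀ n → W n * w n ≡ 1ℚ
    Ww≡1 n = proj₂ (proj₂ (inverse (W n) (0<W n)))

    -- The remainders of the comparison series with denominators `β`, which has the same sum `ρ 0`
    -- as the given tail.
    σ : ℕ → ℚ
    σ 0             = ρ 0
    σ 1             = ρ 0 - x₀
    σ (suc (suc n)) = w n

    β : ℕ → ℚ
    β 0             = β₀
    β 1             = β₁
    β (suc (suc n)) = W n + 1ℚ

    0<β : ∀ n → 0ℚ < β n
    0<β 0             = 0<β₀
    0<β 1             = 0<β₁
    0<β (suc (suc n)) = 0<+ (0<W n) 0≤1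

    Q₁σ₁≡P₁ : Q₁ * σ 1 ≡ P₁
    Q₁σ₁≡P₁ = begin
      q * (B + ½) * (ρ 0 - x₀)              ≡⟨ expand q B (ρ 0) x₀ ⟩
      (q * ρ 0) * (B + ½) - q * (β₀ * x₀)   ≡⟨ cong₂ (λ y z → y * (B + ½) - q * z) ρ₀ β₀x₀≡1 ⟩
      p * (B + ½) - q * 1ℚ                  ≡⟨ expand′ p B q ⟩
      p * B - q + ½ * p                     ≡⟨ cong (λ y → y - q + ½ * p) pB≡q+l ⟩
      q + l - q + ½ * p                     ≡⟨ cancel q l (½ * p) ⟩
      l + ½ * p                             ∎
      where
      open ≡-Reasoning
      expand : ∀ q B r x → q * (B + ½) * (r - x) ≡ (q * r) * (B + ½) - q * ((B + ½) * x)
      expand = solve-∀ ring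
      expand′ : ∀ p B q → p * (B + ½) - q * 1ℚ ≡ p * B - q + ½ * p
      expand′ = solve-∀ ring
      cancel : ∀ q l y → q + l - q + y ≡ l + y
      cancel = solve-∀ ring

    σ-step : ∀ n → β n * (σ n - σ (suc n)) ≡ 1ℚ
    σ-step 0 = trans (cong (β₀ *_) (cancel (ρ 0) x₀)) β₀x₀≡1
      where
      cancel : ∀ r x → r - (r - x) ≡ x
      cancel = solve-∀ ring
    σ-step 1 = cancelˡ-≡ Q₁ 0<Q₁ (begin
      Q₁ * (β₁ * (σ 1 - w 0))               ≡⟨ expand Q₁ β₁ (σ 1) (w 0) ⟩
      (Q₁ * σ 1) * β₁ - W₀ * w 0            ≡⟨ cong₂ (λ y z → y * β₁ - z) Q₁σ₁≡P₁ (Ww≡1 0) ⟩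
      P₁ * β₁ - 1ℚ                          ≡⟨ cong (_- 1ℚ) P₁β₁≡Q₁+1 ⟩
      Q₁ + 1ℚ - 1ℚ                          ≡⟨ cancel Q₁ ⟩
      Q₁ * 1ℚ                               ∎)
      where
      open ≡-Reasoning
      expand : ∀ Q b s w → Q * (b * (s - w)) ≡ (Q * s) * b - (Q * b) * w
      expand = solve-∀ ring
      cancel : ∀ x → x + 1ℚ - 1ℚ ≡ x * 1ℚ
      cancel = solve-∀ ring
    σ-step (suc (suc n)) = cancelˡ-≡ (W n) (0<W n) (begin
      W n * ((W n + 1ℚ) * (w n - w (suc n)))                   ≡⟨ expand (W n) (w n) (w (suc n)) ⟩
      (W n + 1ℚ) * (W n * w n) - W (suc n) * w (suc n)
        ≡⟨ cong₂ (λ y z → (W n + 1ℚ) * y - z) (Ww≡1 n) (Ww≡1 (suc n)) ⟩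
      (W n + 1ℚ) * 1ℚ - 1ℚ                                     ≡⟨ cancel (W n) ⟩
      W n * 1ℚ                                                 ∎)
      where
      open ≡-Reasoning
      expand : ∀ W w w′ → W * ((W + 1ℚ) * (w - w′)) ≡ (W + 1ℚ) * (W * w) - W * (W + 1ℚ) * w′
      expand = solve-∀ ring
      cancel : ∀ x → (x + 1ℚ) * 1ℚ - 1ℚ ≡ x * 1ℚ
      cancel = solve-∀ ring

    u : ℕ → ℚ
    u n = α n * (σ n - σ (suc n))

    u*β : ∀ n → u n * β n ≡ α n
    u*β n = trans (regroup (α n) (σ n - σ (suc n)) (β n))
      (trans (cong (α n *_) (σ-step n)) (*-identityʳ (α n)))
      where
      regroup : ∀ a s b → a * s * b ≡ a * (b * s)
      regroup = solve-∀ ring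

    -- `u i` is the ratio `α i / β i`, and `W n` is `q` times the product of the first `n + 2`
    -- values of `β`.
    ∏u*W : ∀ n → ∏ u (suc (suc n)) * W n ≡ q * ∏ α (suc (suc n))
    ∏u*W zero = trans (regroup (u 0) (u 1) q β₀ β₁) (cong₂ (λ y z → q * (1ℚ * y * z)) (u*β 0) (u*β 1))
      where
      regroup : ∀ u v q b c → 1ℚ * u * v * (q * b * c) ≡ q * (1ℚ * (u * b) * (v * c))
      regroup = solve-∀ ring
    ∏u*W (suc n) = begin
      ∏ u (2 ℕ.+ n) * u (2 ℕ.+ n) * (W n * (W n + 1ℚ))
        ≡⟨ regroup (∏ u (2 ℕ.+ n)) (u (2 ℕ.+ n)) (W n) (W n + 1ℚ) ⟩
      (∏ u (2 ℕ.+ n) * W n) * (u (2 ℕ.+ n) * β (2 ℕ.+ n))      ≡⟨ cong₂ _*_ (∏u*W n) (u*β (2 ℕ.+ n)) ⟩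
      q * ∏ α (2 ℕ.+ n) * α (2 ℕ.+ n)                          ≡⟨ *-assoc q _ _ ⟩
      q * (∏ α (2 ℕ.+ n) * α (2 ℕ.+ n))                        ∎
      where
      open ≡-Reasoning
      regroup : ∀ a b c d → a * b * (c * d) ≡ (a * c) * (b * d)
      regroup = solve-∀ ring

    0<α : ∀ n → 0ℚ < α n
    0<α zero    = <-≤-trans (0<+ 0<B 0≤1) B+1≤α₀
    0<α (suc n) = <-≤-trans (0<α n) (α-mono n)

    0≤ρ : ∀ n → 0ℚ ≤ ρ n
    0≤ρ n = <⇒≤ (0<-factor (q * ∏ α n) (0<* 0<q (0<∏ n)) (<-≤-trans 0<1 (integral n)))
      where
      0<∏ : ∀ n → 0ℚ < ∏ α n
      0<∏ zero    = 0<1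
      0<∏ (suc n) = 0<* (0<∏ n) (0<α n)

    -- After no term the remainders agree; after one, the given series has lost less, since
    -- `α 0 ≥ B + 1 > β₀`. Later, `∏ u ≤ 1` means that `q * ∏ α` is at most `W n`, while `integral`
    -- bounds the remainder below by the reciprocal of `q * ∏ α`.
    criterion : ∀ n → ∏ u n ≤ 1ℚ → σ n ≤ ρ n
    criterion 0 _ = ≤-refl
    criterion 1 _ = cancelˡ-≤ (α 0) (0<α 0) (by-≤ (0≤* (≤⇒0≤ β₀≤α₀) (<⇒≤ 0<x₀)) (begin
      α 0 * ρ 1 - α 0 * (ρ 0 - x₀)                     ≡⟨ expand (α 0) (ρ 0) (ρ 1) x₀ ⟩
      α 0 * x₀ - α 0 * (ρ 0 - ρ 1)                     ≡⟨ cong (λ y → α 0 * x₀ - y) (trans (ρ-step 0) (sym β₀x₀≡1)) ⟩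
      α 0 * x₀ - β₀ * x₀                               ≡⟨ factor (α 0) β₀ x₀ ⟩
      (α 0 - β₀) * x₀                                  ∎))
      where
      open ≡-Reasoning
      0<x₀ = proj₁ (proj₂ (inverse β₀ 0<β₀))
      β₀≤α₀ : β₀ ≤ α 0
      β₀≤α₀ = ≤-trans (by-≤ ½≥0 (halve B)) B+1≤α₀
        where
        halve : ∀ B → B + 1ℚ - (B + ½) ≡ ½
        halve = solve-∀ ring
      expand : ∀ a r r′ x → a * r′ - a * (r - x) ≡ a * x - a * (r - r′)
      expand = solve-∀ ring
      factor : ∀ a b x → a * x - b * x ≡ (a - b) * x
      factor = solve-∀ ring
    criterion (suc (suc n)) ∏u≤1 = begin
      w n                                              ≡⟨ *-identityʳ (w n) ⟨
      w n * 1ℚ                                         ≤⟨ *-monoˡ (<⇒≤ (0<w n)) (integral (2 ℕ.+ n)) ⟩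
      w n * (q * ∏ α (2 ℕ.+ n) * ρ (2 ℕ.+ n))          ≡⟨ cong (λ y → w n * (y * ρ (2 ℕ.+ n))) (∏u*W n) ⟨
      w n * (∏ u (2 ℕ.+ n) * W n * ρ (2 ℕ.+ n))        ≡⟨ regroup (w n) (∏ u (2 ℕ.+ n)) (W n) (ρ (2 ℕ.+ n)) ⟩
      (W n * w n * ρ (2 ℕ.+ n)) * ∏ u (2 ℕ.+ n)        ≡⟨ cong (λ y → y * ρ (2 ℕ.+ n) * ∏ u (2 ℕ.+ n)) (Ww≡1 n) ⟩
      (1ℚ * ρ (2 ℕ.+ n)) * ∏ u (2 ℕ.+ n)               ≡⟨ cong (_* ∏ u (2 ℕ.+ n)) (*-identityˡ (ρ (2 ℕ.+ n))) ⟩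
      ρ (2 ℕ.+ n) * ∏ u (2 ℕ.+ n)                      ≤⟨ *-monoˡ (0≤ρ (2 ℕ.+ n)) ∏u≤1 ⟩
      ρ (2 ℕ.+ n) * 1ℚ                                 ≡⟨ *-identityʳ (ρ (2 ℕ.+ n)) ⟩
      ρ (2 ℕ.+ n)                                      ∎
      where
      open ≤-Reasoning
      regroup : ∀ w u W r → w * (u * W * r) ≡ W * w * r * u
      regroup = solve-∀ ring

    σ-decreasing : ∀ n → 0ℚ ≤ σ n - σ (suc n)
    σ-decreasing n = <⇒≤ (0<-factor (β n) (0<β n) (subst (0ℚ <_) (sym (σ-step n)) 0<1))

    remainder-bound : ∀ n → 1ℚ ≤ W n * ρ (2 ℕ.+ n)
    remainder-bound n = subst (_≤ W n * ρ (2 ℕ.+ n)) (Ww≡1 n) (*-monoˡ (<⇒≤ (0<W n))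
      (majorization α ρ σ (λ n → <⇒≤ (0<α n)) α-mono ρ-step σ-decreasing criterion (2 ℕ.+ n)))

    -- The greedy series has second denominator `(q * B + 1) / l`, so the right side is `l` times
    -- the reciprocal of its remainder after two terms. Multiplying by `P₁` removes `β₁`; after
    -- substituting `p * B = q + l` the difference is a quarter of `q * q` times the slack in
    -- `small-l`.
    W₀-small : l * W₀ < q * B * (q * B + 1ℚ)
    W₀-small = cancelˡ-< P₁ 0<P₁ (by-< (0<* (0<* (0<* 0<q 0<q) 0<¼) (<⇒0< small-l)) (begin
      P₁ * (q * B * (q * B + 1ℚ)) - P₁ * (l * (Q₁ * β₁))     ≡⟨ regroup P₁ q B l Q₁ β₁ ⟩
      P₁ * (q * B * (q * B + 1ℚ)) - l * Q₁ * (P₁ * β₁)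
        ≡⟨ cong (λ y → P₁ * (q * B * (q * B + 1ℚ)) - l * Q₁ * y) P₁β₁≡Q₁+1 ⟩
      P₁ * (q * B * (q * B + 1ℚ)) - l * Q₁ * (Q₁ + 1ℚ)       ≡⟨ expand l p q B ⟩
      q * ((l * B + ½ * (p * B)) * (q * B + 1ℚ) - l * (B + ½) * (q * (B + ½) + 1ℚ))
        ≡⟨ cong (λ y → q * ((l * B + ½ * y) * (q * B + 1ℚ) - l * (B + ½) * (q * (B + ½) + 1ℚ))) pB≡q+l ⟩
      q * ((l * B + ½ * (q + l)) * (q * B + 1ℚ) - l * (B + ½) * (q * (B + ½) + 1ℚ))
        ≡⟨ final l q B ⟩
      q * q * (½ * ½) * (q * B + q * B + (1ℚ + 1ℚ) - l * (B + B + 1ℚ)) ∎))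
      where
      open ≡-Reasoning
      0<¼ : 0ℚ < ½ * ½
      0<¼ = positive⁻¹ (½ * ½)
      regroup : ∀ P q B l Q b → P * (q * B * (q * B + 1ℚ)) - P * (l * (Q * b))
        ≡ P * (q * B * (q * B + 1ℚ)) - l * Q * (P * b)
      regroup = solve-∀ ring
      expand : ∀ l p q B → (l + ½ * p) * (q * B * (q * B + 1ℚ)) - l * (q * (B + ½)) * (q * (B + ½) + 1ℚ)
        ≡ q * ((l * B + ½ * (p * B)) * (q * B + 1ℚ) - l * (B + ½) * (q * (B + ½) + 1ℚ))
      expand = solve-∀ ring
      final : ∀ l q B → q * ((l * B + ½ * (q + l)) * (q * B + 1ℚ) - l * (B + ½) * (q * (B + ½) + 1ℚ))
        ≡ q * q * (½ * ½) * (q * B + q * B + (1ℚ + 1ℚ) - l * (B + B + 1ℚ))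
      final = solve-∀ ring

  -- Growth of powers and of the Sylvester recursion

  opaque
    crossing : (P : ℕ → Set) → (∀ n → Dec (P n)) → ¬ P 0 → ∀ k → P k → ∃[ i ] (¬ P i × P (suc i))
    crossing P P? ¬P₀ zero    P₀ = contradiction P₀ ¬P₀
    crossing P P? ¬P₀ (suc k) Pk with P? k
    ... | yes p = crossing P P? ¬P₀ k p
    ... | no ¬p = k , ¬p , Pk

  ≤^ : ∀ m .{{_ : ℕ.NonZero m}} {r} → 1ℚ ≤ r → r ≤ r ^ m
  ≤^ (suc m) {r} 1≤r = subst (_≤ r ^ suc m) (*-identityʳ r) (*-monoˡ (≤-trans 0≤1 1≤r) (1≤^ m 1≤r))

  ^-mono-< : ∀ m .{{_ : ℕ.NonZero m}} {r s} → 1ℚ ≤ r → r < s → r ^ m < s ^ m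
  ^-mono-< (suc m) {r} {s} 1≤r r<s = ≤-<-trans
    (*-monoˡ (≤-trans 0≤1 1≤r) (^-mono m (≤-trans 0≤1 1≤r) (<⇒≤ r<s)))
    (*-monoˡ-<-pos (s ^ m) {{positive (<-≤-trans 0<1 (1≤^ m (≤-trans 1≤r (<⇒≤ r<s))))}} r<s)

  archimedean-* : ∀ {δ} x → 0ℚ < δ → ∃[ n ] (∀ m → n ℕ.≤ m → x ≤ ι m * δ)
  archimedean-* {δ} x 0<δ = let n , x/δ<n = archimedean (x * δ⁻¹) in n , λ m n≤m →
    subst (_≤ ι m * δ) x/δ*δ≡x (*-monoʳ (<⇒≤ 0<δ) (≤-trans (<⇒≤ x/δ<n) (ι-mono-≤ n≤m)))
    where
    δ⁻¹ = proj₁ (inverse δ 0<δ)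
    regroup : ∀ a b c → a * b * c ≡ a * (c * b)
    regroup = solve-∀ ring
    x/δ*δ≡x : x * δ⁻¹ * δ ≡ x
    x/δ*δ≡x = trans (regroup x δ⁻¹ δ) (trans (cong (x *_) (proj₂ (proj₂ (inverse δ 0<δ)))) (*-identityʳ x))

  powers-dense : ∀ M .{{_ : ℕ.NonZero M}} {u v} → 1ℚ ≤ u → u < v → ∃[ c ] (1ℚ ≤ c × u ≤ c ^ M × c ^ M < v)
  powers-dense M {u} {v} 1≤u u<v = K ^ i , 1≤^ i 1≤K , u≤ , ≰⇒> v≰
    where
    0<u = <-≤-trans 0<1 1≤u
    u⁻¹ = proj₁ (inverse u 0<u)
    uu⁻¹≡1 = proj₂ (proj₂ (inverse u 0<u))

    uu⁻¹v≡v : u * (u⁻¹ * v) ≡ v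
    uu⁻¹v≡v = trans (sym (*-assoc u u⁻¹ v)) (trans (cong (_* v) uu⁻¹≡1) (*-identityˡ v))

    root = ^-rounded M {1ℚ} {u⁻¹ * v} 0≤1
      (cancelˡ-< u 0<u (subst₂ _<_ (sym (trans (cong (u *_) (1^ M)) (*-identityʳ u))) (sym uu⁻¹v≡v) u<v))
    K = proj₁ root
    1<K = proj₁ (proj₂ root)
    1≤K = <⇒≤ 1<K
    0≤K = ≤-trans 0≤1 1≤K

    uKᴹ<v : u * K ^ M < v
    uKᴹ<v = subst (u * K ^ M <_) uu⁻¹v≡v (*-monoʳ-<-pos u {{positive 0<u}} (proj₂ (proj₂ root)))

    large = archimedean-* v (<⇒0< 1<K)
    k = proj₁ large

    v≤Kᵏ : v ≤ K ^ k
    v≤Kᵏ = ≤-trans (proj₂ large k ℕ.≤-refl)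
      (≤-trans (subst (_≤ 1ℚ ^ k + ι k * (K - 1ℚ)) (+-identityˡ _) (+-monoˡ-≤ _ (^-nonNeg k 0≤1)))
        (subst (λ y → 1ℚ ^ k + ι k * (K - 1ℚ) ≤ y ^ k) (add-difference 1ℚ K) (bernoulli k ≤-refl (<⇒≤ (<⇒0< 1<K)))))

    crossed = crossing (λ i → v ≤ (K ^ i) ^ M) (λ i → v ≤? (K ^ i) ^ M)
      (λ v≤1 → <-irrefl refl (<-≤-trans u<v (≤-trans v≤1 (≤-trans (≤-reflexive (1^ M)) 1≤u))))
      k (≤-trans v≤Kᵏ (≤^ M (1≤^ k 1≤K)))
    i = proj₁ crossed
    v≰ = proj₁ (proj₂ crossed)

    u≤ : u ≤ (K ^ i) ^ M
    u≤ = ≮⇒≥ λ Kⁱᴹ<u → <-irrefl refl (≤-<-trans (proj₂ (proj₂ crossed)) (≤-<-trans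
      (≤-trans (≤-reflexive (trans (^-*-distrib K (K ^ i) M) (*-comm (K ^ M) ((K ^ i) ^ M))))
        (*-monoʳ (^-nonNeg M 0≤K) (<⇒≤ Kⁱᴹ<u)))
      uKᴹ<v))

  0^ : ∀ m .{{_ : ℕ.NonZero m}} → 0ℚ ^ m ≡ 0ℚ
  0^ (suc m) = *-zeroˡ (0ℚ ^ m)

  -- By `bernoulli`, lowering a base by `δ` lowers its `m`-th power by at least `m * δ ≥ 1` as long
  -- as the new base is at least 1. Below 1 the power is at most 1, hence less than `D`, unless the
  -- base is negative.
  ^-decrease : ∀ m {D x δ} → 1ℚ < D → 0ℚ ≤ δ → 1ℚ ≤ ι m * δ → x ^ m < D + 1ℚ →
    x - δ < 0ℚ ⊎ (x - δ) ^ m < D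
  ^-decrease m {D} {x} {δ} 1<D 0≤δ 1≤mδ xᵐ<D+1 with x - δ <? 0ℚ | ≤-total 1ℚ (x - δ)
  ... | yes y<0 | _ = inj₁ y<0
  ... | no y≮0 | inj₂ y≤1 = inj₂ (≤-<-trans (^-mono m (≮⇒≥ y≮0) y≤1) (subst (_< D) (sym (1^ m)) 1<D))
  ... | no _ | inj₁ 1≤y = inj₂ (by-< (<⇒0< yᵐ+1<D+1) (cancel ((x - δ) ^ m) D))
    where
    restore : ∀ x δ → x - δ + δ ≡ x
    restore = solve-∀ ring
    cancel : ∀ y D → D - y ≡ D + 1ℚ - (y + 1ℚ)
    cancel = solve-∀ ring
    yᵐ+1<D+1 : (x - δ) ^ m + 1ℚ < D + 1ℚ
    yᵐ+1<D+1 = ≤-<-trans (+-monoʳ-≤ ((x - δ) ^ m) 1≤mδ) (≤-<-trans (bernoulli m 1≤y 0≤δ)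
      (subst (λ z → z ^ m < D + 1ℚ) (sym (restore x δ)) xᵐ<D+1))

  -- The `m`-th roots of `D` and `D + 1` are thus within `2 * δ`. The witness `r` is a multiple of
  -- `δ` at which the `m`-th power first reaches `D + 1`; one `δ` lower the power is below `D + 1`,
  -- and another `δ` lower `^-decrease` applies.
  root-within : ∀ m .{{_ : ℕ.NonZero m}} {D δ} → 1ℚ < D → 0ℚ < δ → 1ℚ ≤ ι m * δ →
    ∃[ r ] (0ℚ ≤ r × D + 1ℚ ≤ r ^ m × (r - (δ + δ) < 0ℚ ⊎ (r - (δ + δ)) ^ m < D))
  root-within m {D} {δ} 1<D 0<δ 1≤Mδ = r , 0≤* (0≤ι (suc i)) 0≤δ , proj₂ (proj₂ crossed)
    , subst (λ z → z < 0ℚ ⊎ z ^ m < D) (sym r-2δ)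
        (^-decrease m {x = ι i * δ} 1<D 0≤δ 1≤Mδ (≰⇒> (proj₁ (proj₂ crossed))))
    where
    0≤δ = <⇒≤ 0<δ
    large = archimedean-* (D + 1ℚ) 0<δ
    k = proj₁ large

    D+1≤kδ : D + 1ℚ ≤ ι k * δ
    D+1≤kδ = proj₂ large k ℕ.≤-refl

    1≤kδ : 1ℚ ≤ ι k * δ
    1≤kδ = ≤-trans (+-monoˡ-≤ 1ℚ (≤-trans 0≤1 (<⇒≤ 1<D))) D+1≤kδ

    D+1≰0 : ¬ (D + 1ℚ ≤ (ι 0 * δ) ^ m)
    D+1≰0 D+1≤0 = <-irrefl refl (<-≤-trans (0<+ (<-trans 0<1 1<D) 0≤1)
      (subst (D + 1ℚ ≤_) (trans (cong (_^ m) (trans (cong (_* δ) ι0≡0) (*-zeroˡ δ))) (0^ m)) D+1≤0))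

    crossed = crossing (λ i → D + 1ℚ ≤ (ι i * δ) ^ m) (λ i → D + 1ℚ ≤? (ι i * δ) ^ m)
      D+1≰0 k (≤-trans D+1≤kδ (≤^ m 1≤kδ))
    i = proj₁ crossed
    r = ι (suc i) * δ

    cancel : ∀ i δ → (1ℚ + i) * δ - (δ + δ) ≡ i * δ - δ
    cancel = solve-∀ ring

    r-2δ : r - (δ + δ) ≡ ι i * δ - δ
    r-2δ = trans (cong (λ k → k * δ - (δ + δ)) (ι-suc i)) (cancel (ι i) δ)

  -- An upper bound propagates because `s * (s + 1) + 1` is at most the square of `s + 1`, while the
  -- power of `r` is squared.
  sylvester-+1 : ∀ {w} e {r} → 0ℚ < w → w + 1ℚ ≤ r ^ (2 ℕ.^ e) →
    ∀ k → sylvester w k + 1ℚ ≤ r ^ (2 ℕ.^ (k ℕ.+ e))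
  sylvester-+1 e 0<w w+1≤ zero = w+1≤
  sylvester-+1 {w} e {r} 0<w w+1≤ (suc k) = ≤-trans
    (by-≤ 0≤s (expand s))
    (≤-trans (*-mono 0≤s+1 0≤s+1 IH IH) (≤-reflexive (sym (^2^-suc r (k ℕ.+ e)))))
    where
    s = sylvester w k
    0≤s = <⇒≤ (sylvester-pos 0<w k)
    0≤s+1 = 0≤+ 0≤s 0≤1
    IH = sylvester-+1 e {r} 0<w w+1≤ k
    expand : ∀ s → (s + 1ℚ) * (s + 1ℚ) - (s * (s + 1ℚ) + 1ℚ) ≡ s
    expand = solve-∀ ring

  sylvester-+ : ∀ w j k → sylvester (sylvester w k) j ≡ sylvester w (j ℕ.+ k)
  sylvester-+ w zero    k = refl
  sylvester-+ w (suc j) k = cong (λ s → s * (s + 1ℚ)) (sylvester-+ w j k)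

  -- A lower bound propagates because `s * (s + 1)` exceeds the square of `s`.
  ^<sylvester : ∀ {w} e {r} → 0ℚ < w → 0ℚ ≤ r → r ^ (2 ℕ.^ e) < w →
    ∀ k → r ^ (2 ℕ.^ (k ℕ.+ e)) < sylvester w k
  ^<sylvester e 0<w 0≤r r<w zero = r<w
  ^<sylvester {w} e {r} 0<w 0≤r r<w (suc k) = ≤-<-trans
    (≤-trans (≤-reflexive (^2^-suc r (k ℕ.+ e))) (*-mono 0≤rᴹ 0≤rᴹ (<⇒≤ IH) (<⇒≤ IH)))
    (by-< (sylvester-pos 0<w k) (expand (sylvester w k)))
    where
    0≤rᴹ = ^-nonNeg (2 ℕ.^ (k ℕ.+ e)) 0≤r
    IH = ^<sylvester e 0<w 0≤r r<w k
    expand : ∀ s → s * (s + 1ℚ) - s * s ≡ s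
    expand = solve-∀ ring

  -- Both bounds propagate to the common index `n + m`, where they contradict each other.
  sylvester-separates : ∀ {w} e {r} → 0ℚ < w → 0ℚ ≤ r → ∀ m n →
    r ^ (2 ℕ.^ (m ℕ.+ e)) < sylvester w m → ¬ (sylvester w n + 1ℚ ≤ r ^ (2 ℕ.^ (n ℕ.+ e)))
  sylvester-separates {w} e {r} 0<w 0≤r m n below above = <-irrefl refl (<-≤-trans below′ (≤-trans
    (by-≤ 0≤1 (cancel (sylvester w (n ℕ.+ m)))) above′))
    where
    cancel : ∀ s → s + 1ℚ - s ≡ 1ℚ
    cancel = solve-∀ ring
    below′ : r ^ (2 ℕ.^ (n ℕ.+ (m ℕ.+ e))) < sylvester w (n ℕ.+ m)
    below′ = subst (_ <_) (sylvester-+ w n m)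
      (^<sylvester (m ℕ.+ e) (sylvester-pos 0<w m) 0≤r below n)
    above′ : sylvester w (n ℕ.+ m) + 1ℚ ≤ r ^ (2 ℕ.^ (n ℕ.+ (m ℕ.+ e)))
    above′ = subst₂ (λ j k → j + 1ℚ ≤ r ^ (2 ℕ.^ k))
      (trans (sylvester-+ w m n) (cong (sylvester w) (ℕ.+-comm m n)))
      (trans (sym (ℕ.+-assoc m n e)) (trans (cong (ℕ._+ e) (ℕ.+-comm m n)) (ℕ.+-assoc n m e)))
      (sylvester-+1 (n ℕ.+ e) (sylvester-pos 0<w n) above m)

  -- One step multiplies the difference of the two sequences by `S + s + 1 ≥ 2`. The linear growth
  -- that follows from this already takes it past 1.
  sylvester-gap : ∀ {v w} → 0ℚ < v → v < w → 1ℚ ≤ w → ∃[ k ] sylvester v k + 1ℚ < sylvester w k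
  sylvester-gap {v} {w} 0<v v<w 1≤w = k , by-< (<⇒0< 1<dₖ) (regroup (sylvester w k) (sylvester v k))
    where
    d = w - v
    0<d = <⇒0< v<w
    0≤d = <⇒≤ 0<d

    0≤s = λ k → <⇒≤ (sylvester-pos 0<v k)

    1≤S : ∀ k → 1ℚ ≤ sylvester w k
    1≤S zero    = 1≤w
    1≤S (suc k) = ≤-trans (1≤S k) (subst (_≤ S * (S + 1ℚ)) (*-identityʳ S) (*-monoˡ 0≤S (+-monoˡ-≤ 1ℚ 0≤S)))
      where
      S = sylvester w k
      0≤S = ≤-trans 0≤1 (1≤S k)

    regroup : ∀ a b → a - (b + 1ℚ) ≡ a - b - 1ℚ
    regroup = solve-∀ ring

    expand : ∀ n d s S → S * (S + 1ℚ) - s * (s + 1ℚ) - (d + (1ℚ + n) * d)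
      ≡ (S - s - (d + n * d)) + (S - s - (d + n * d)) + n * d + (S - s) * (S - 1ℚ + s)
    expand = solve-∀ ring

    growth : ∀ k → d + ι k * d ≤ sylvester w k - sylvester v k
    growth zero    = ≤-reflexive (trans (cong (λ k → d + k * d) ι0≡0)
      (trans (cong (_+_ d) (*-zeroˡ d)) (+-identityʳ d)))
    growth (suc k) = by-≤
      (0≤+ (0≤+ (0≤+ (≤⇒0≤ (growth k)) (≤⇒0≤ (growth k))) (0≤* (0≤ι k) 0≤d))
        (0≤* (≤-trans (0≤+ 0≤d (0≤* (0≤ι k) 0≤d)) (growth k)) (0≤+ (≤⇒0≤ (1≤S k)) (0≤s k))))
      (trans (cong (λ j → sylvester w (suc k) - sylvester v (suc k) - (d + j * d)) (ι-suc k))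
        (expand (ι k) d (sylvester v k) (sylvester w k)))

    large = archimedean-* 1ℚ 0<d
    k = proj₁ large

    1<dₖ : 1ℚ < sylvester w k - sylvester v k
    1<dₖ = <-≤-trans (≤-<-trans (proj₂ large k ℕ.≤-refl)
      (subst (_< d + ι k * d) (+-identityˡ (ι k * d)) (+-monoˡ-< (ι k * d) 0<d))) (growth k)

  -- With h = s ^ 2 ^ (n + 1) the bound 1 / (h - 1) telescopes, because
  -- 1 / h ≤ 1 / (h - 1) - 1 / (h ^ 2 - 1).
  remainder-of-fast-series : (a R : ℕ → ℚ) → (∀ n → a n * (R n - R (suc n)) ≡ 1ℚ) →
    (∀ ε → 0ℚ < ε → ∃[ N ] ∀ n → N ℕ.≤ n → R n < ε) →
    ∀ {s} → 1ℚ < s → ∀ N → (∀ n → N ℕ.≤ n → s ^ (2 ℕ.^ suc n) ≤ a n) →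
    ∀ n → N ℕ.≤ n → R n * (s ^ (2 ℕ.^ suc n) - 1ℚ) ≤ 1ℚ
  remainder-of-fast-series a R R-step R→0 {s} 1<s N fast n N≤n = ≮⇒≥ impossible
    where
    h : ℕ → ℚ
    h n = s ^ (2 ℕ.^ suc n)

    1<h : ∀ n → 1ℚ < h n
    1<h n = subst (_< h n) (1^ (2 ℕ.^ suc n)) (^-mono-< (2 ℕ.^ suc n) {{ℕ.m^n≢0 2 (suc n)}} ≤-refl 1<s)

    0<h-1 : ∀ n → 0ℚ < h n - 1ℚ
    0<h-1 n = <⇒0< (1<h n)

    g : ℕ → ℚ
    g n = proj₁ (inverse (h n - 1ℚ) (0<h-1 n))

    0<g : ∀ n → 0ℚ < g n
    0<g n = proj₁ (proj₂ (inverse (h n - 1ℚ) (0<h-1 n)))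

    hg≡1 : ∀ n → (h n - 1ℚ) * g n ≡ 1ℚ
    hg≡1 n = proj₂ (proj₂ (inverse (h n - 1ℚ) (0<h-1 n)))

    step : ∀ m → N ℕ.≤ m → R m - g m ≤ R (suc m) - g (suc m)
    step m N≤m = cancelˡ-≤ (h m * h m - 1ℚ) 0<h²-1 (by-≤
      (0≤+ (0≤* (<⇒≤ (<-trans 0<1 (1<h m))) (≤⇒0≤ hy≤1)) 0≤y) (begin
      H * (R (suc m) - g (suc m)) - H * (R m - g m)                  ≡⟨ expand (h m) (R m) (R (suc m)) (g m) (g (suc m)) ⟩
      (h m + 1ℚ) * ((h m - 1ℚ) * g m) - H * g (suc m) - H * y
        ≡⟨ cong₂ (λ j k → (h m + 1ℚ) * j - k - H * y) (hg≡1 m) Hg≡1 ⟩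
      (h m + 1ℚ) * 1ℚ - 1ℚ - H * y                                   ≡⟨ regroup (h m) y ⟩
      h m * (1ℚ - h m * y) + y                                       ∎))
      where
      open ≡-Reasoning
      H = h m * h m - 1ℚ
      y = R m - R (suc m)
      0<a = <-≤-trans (<-trans 0<1 (1<h m)) (fast m N≤m)
      0≤y : 0ℚ ≤ y
      0≤y = <⇒≤ (0<-factor (a m) 0<a (subst (0ℚ <_) (sym (R-step m)) 0<1))
      hy≤1 : h m * y ≤ 1ℚ
      hy≤1 = ≤-trans (*-monoʳ 0≤y (fast m N≤m)) (≤-reflexive (R-step m))
      H≡ : h (suc m) - 1ℚ ≡ H
      H≡ = cong (_- 1ℚ) (^2^-suc s (suc m))
      0<h²-1 : 0ℚ < H
      0<h²-1 = subst (0ℚ <_) H≡ (0<h-1 (suc m))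
      Hg≡1 : H * g (suc m) ≡ 1ℚ
      Hg≡1 = trans (cong (_* g (suc m)) (sym H≡)) (hg≡1 (suc m))
      expand : ∀ h r r′ g g′ → (h * h - 1ℚ) * (r′ - g′) - (h * h - 1ℚ) * (r - g)
        ≡ (h + 1ℚ) * ((h - 1ℚ) * g) - (h * h - 1ℚ) * g′ - (h * h - 1ℚ) * (r - r′)
      expand = solve-∀ ring
      regroup : ∀ h y → (h + 1ℚ) * 1ℚ - 1ℚ - (h * h - 1ℚ) * y ≡ h * (1ℚ - h * y) + y
      regroup = solve-∀ ring

    mono : ∀ k → R n - g n ≤ R (k ℕ.+ n) - g (k ℕ.+ n)
    mono zero    = ≤-refl
    mono (suc k) = ≤-trans (mono k) (step (k ℕ.+ n) (ℕ.≤-trans N≤n (ℕ.m≤n+m n k)))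

    -- Otherwise `R n - g n` is positive, and by `mono` it is a lower bound for all later `R`, which
    -- tend to 0.
    impossible : ¬ 1ℚ < R n * (h n - 1ℚ)
    impossible 1<Rh = <-irrefl refl (<-≤-trans (proj₂ vanishing (N₁ ℕ.+ n) (ℕ.m≤m+n N₁ n))
      (≤-trans (mono N₁) (by-≤ (<⇒≤ (0<g (N₁ ℕ.+ n))) (cancel (R (N₁ ℕ.+ n)) (g (N₁ ℕ.+ n))))))
      where
      0<ε : 0ℚ < R n - g n
      0<ε = <⇒0< (cancelˡ-< (h n - 1ℚ) (0<h-1 n)
        (subst₂ _<_ (sym (hg≡1 n)) (*-comm (R n) (h n - 1ℚ)) 1<Rh))
      vanishing = R→0 (R n - g n) 0<ε
      N₁ = proj₁ vanishing
      cancel : ∀ r g → r - (r - g) ≡ g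
      cancel = solve-∀ ring

  -- Remainders of series of unit fractions

  remainder : ℚ → (ℕ → ℕ) → ℕ → ℚ
  remainder lam a n = lam - partialSum a n

  remainder-suc : ∀ lam a n → remainder lam a (suc n) ≡ remainder lam a n - unitFraction (a n)
  remainder-suc lam a n = regroup lam (partialSum a n) (unitFraction (a n))
    where
    regroup : ∀ l s u → l - (s + u) ≡ l - s - u
    regroup = solve-∀ ring

  remainder-step : ∀ lam a n → 0 ℕ.< a n → ι (a n) * (remainder lam a n - remainder lam a (suc n)) ≡ 1ℚ
  remainder-step lam a n 0<a = trans (regroup (ι (a n)) lam (partialSum a n) (unitFraction (a n))) (unitFraction-* 0<a)
    where
    regroup : ∀ x l s u → x * (l - s - (l - (s + u))) ≡ u * x
    regroup = solve-∀ ring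

  x≤∣x∣ : ∀ x → x ≤ ∣ x ∣
  x≤∣x∣ x with ≤-total 0ℚ x
  ... | inj₁ 0≤x = ≤-reflexive (sym (0≤p⇒∣p∣≡p 0≤x))
  ... | inj₂ x≤0 = ≤-trans x≤0 (0≤∣p∣ x)

  -x≤∣x∣ : ∀ x → - x ≤ ∣ x ∣
  -x≤∣x∣ x = subst (- x ≤_) (∣-p∣≡∣p∣ x) (x≤∣x∣ (- x))

  remainder→0 : ∀ {lam a} → HasSum a lam → ∀ ε → 0ℚ < ε → ∃[ N ] ∀ n → N ℕ.≤ n → remainder lam a n < ε
  remainder→0 {lam} {a} sum ε 0<ε = let N , close = sum ε 0<ε in N , λ n N≤n →
    ≤-<-trans (subst (_≤ ∣ partialSum a n - lam ∣) (negate (partialSum a n) lam) (-x≤∣x∣ (partialSum a n - lam)))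
      (close n N≤n)
    where
    negate : ∀ s l → - (s - l) ≡ l - s
    negate = solve-∀ ring

  -- The remainders decrease strictly, so after a nonpositive one all later ones would be bounded
  -- away from 0 by the next, negative one.
  remainder-pos : ∀ {lam a} → (∀ n → 0 ℕ.< a n) → HasSum a lam → ∀ n → 0ℚ < remainder lam a n
  remainder-pos {lam} {a} 0<a sum n = ≰⇒> impossible
    where
    R = remainder lam a

    decreasing : ∀ n → R (suc n) < R n
    decreasing n = by-< (0<-factor (ι (a n)) (0<ι (0<a n))
      (subst (0ℚ <_) (sym (remainder-step lam a n (0<a n))) 0<1)) refl

    antitone : ∀ k → R (k ℕ.+ suc n) ≤ R (suc n)
    antitone zero    = ≤-refl
    antitone (suc k) = ≤-trans (<⇒≤ (decreasing (k ℕ.+ suc n))) (antitone k)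

    impossible : ¬ R n ≤ 0ℚ
    impossible R≤0 = <-irrefl refl (<-≤-trans (proj₂ eventually (N ℕ.+ suc n) (ℕ.m≤m+n N (suc n)))
      (≤-trans (neg-antimono-≤ (antitone N))
        (subst (_≤ ∣ partialSum a (N ℕ.+ suc n) - lam ∣) (negate (partialSum a (N ℕ.+ suc n)) lam)
          (x≤∣x∣ (partialSum a (N ℕ.+ suc n) - lam)))))
      where
      negate : ∀ s l → s - l ≡ - (l - s)
      negate = solve-∀ ring
      eventually = sum (- R (suc n)) (neg-antimono-< (<-≤-trans (decreasing n) R≤0))
      N = proj₁ eventually

  partialSum-cong : ∀ {a b} k → (∀ i → i ℕ.< k → a i ≡ b i) → partialSum a k ≡ partialSum b k
  partialSum-cong zero    _    = refl
  partialSum-cong (suc k) same = cong₂ (λ s x → s + unitFraction x)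
    (partialSum-cong k (λ i i<k → same i (ℕ.m<n⇒m<1+n i<k))) (same k ℕ.≤-refl)

  -- q * ∏ α n * ρ n is a positive integer, being an integer combination of the
  -- previous one and of q * ∏ α n.
  integrality : ∀ (α : ℕ → ℕ) (ρ : ℕ → ℚ) p q → 0 ℕ.< q → (∀ n → 0 ℕ.< α n) → (∀ n → 0ℚ < ρ n) →
    (∀ n → ι (α n) * (ρ n - ρ (suc n)) ≡ 1ℚ) → ι q * ρ 0 ≡ ι p →
    ∀ n → 1ℚ ≤ ι q * ∏ (λ i → ι (α i)) n * ρ n
  integrality α ρ p q 0<q 0<α 0<ρ ρ-step ρ₀ n = let P , QR≡P = proj₂ (proj₂ (numerator n)) in
    subst (1ℚ ≤_) (sym QR≡P) (0<ι⇒1≤ι (subst (0ℚ <_) QR≡P (0<* (0<Q n) (0<ρ n))))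
    where
    Q : ℕ → ℚ
    Q n = ι q * ∏ (λ i → ι (α i)) n

    0<∏ : ∀ n → 0ℚ < ∏ (λ i → ι (α i)) n
    0<∏ zero    = 0<1
    0<∏ (suc n) = 0<* (0<∏ n) (0<ι (0<α n))

    0<Q : ∀ n → 0ℚ < Q n
    0<Q n = 0<* (0<ι 0<q) (0<∏ n)

    expand : ∀ q x a r r′ → q * (x * a) * r′ ≡ q * x * r * a - q * x * (a * (r - r′))
    expand = solve-∀ ring

    numerator : ∀ n → ∃[ Qₙ ] (Q n ≡ ι Qₙ × (∃[ P ] Q n * ρ n ≡ ι P))
    numerator zero = q , *-identityʳ (ι q) , p , trans (cong (_* ρ 0) (*-identityʳ (ι q))) ρ₀
    numerator (suc n) with numerator n
    ... | Qₙ , Q≡ , P , QR≡P =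
      Qₙ ℕ.* α n
      , trans (sym (*-assoc (ι q) _ _)) (trans (cong (_* ι (α n)) Q≡) (sym (ι-* Qₙ (α n))))
      , P ℕ.* α n ℕ.∸ Qₙ
      , trans eq (ι-∸ (ℕ.<⇒≤ (ι-cancel-< {Qₙ} {P ℕ.* α n} (by-< (0<* (0<Q (suc n)) (0<ρ (suc n))) (sym eq)))))
      where
      eq : Q (suc n) * ρ (suc n) ≡ ι (P ℕ.* α n) - ι Qₙ
      eq = begin
        Q (suc n) * ρ (suc n)                                       ≡⟨ expand (ι q) _ (ι (α n)) (ρ n) (ρ (suc n)) ⟩
        Q n * ρ n * ι (α n) - Q n * (ι (α n) * (ρ n - ρ (suc n)))
          ≡⟨ cong₂ (λ x y → x * ι (α n) - Q n * y) QR≡P (ρ-step n) ⟩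
        ι P * ι (α n) - Q n * 1ℚ
          ≡⟨ cong₂ _-_ (sym (ι-* P (α n))) (trans (*-identityʳ (Q n)) Q≡) ⟩
        ι (P ℕ.* α n) - ι Qₙ                                        ∎
        where open ≡-Reasoning

  module _ {x} p q {r} (0<x : 0 ℕ.< x) (0<q : 0 ℕ.< q) (qr≡p : ι q * r ≡ ι p) where

    private
      0<qx : 0ℚ < ι q * ι x
      0<qx = 0<* (0<ι 0<q) (0<ι 0<x)

      regroup : ∀ q x u → q * x * u ≡ q * (u * x)
      regroup = solve-∀ ring

      qx/x≡q : ι q * ι x * unitFraction x ≡ ι q
      qx/x≡q = trans (regroup (ι q) (ι x) (unitFraction x))
        (trans (cong (ι q *_) (unitFraction-* 0<x)) (*-identityʳ (ι q)))

      qxr≡px : ι q * ι x * r ≡ ι (p ℕ.* x)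
      qxr≡px = trans (regroup (ι q) (ι x) r)
        (trans (sym (*-assoc (ι q) r (ι x))) (trans (cong (_* ι x) qr≡p) (sym (ι-* p x))))

    unitFraction-< : q ℕ.< p ℕ.* x → unitFraction x < r
    unitFraction-< q<px = cancelˡ-< (ι q * ι x) 0<qx (subst₂ _<_ (sym qx/x≡q) (sym qxr≡px) (ι-mono-< q<px))

    unitFraction-<⁻¹ : unitFraction x < r → q ℕ.< p ℕ.* x
    unitFraction-<⁻¹ u<r = ι-cancel-< (subst₂ _<_ qx/x≡q qxr≡px (*-monoʳ-<-pos (ι q * ι x) {{positive 0<qx}} u<r))

  -- The greedy series

  IsLeast-unique : ∀ {P m k} → IsLeast P m → P k → (∀ j → P j → k ℕ.≤ j) → m ≡ k
  IsLeast-unique (Pm , least) Pk least′ = ℕ.≤-antisym (least _ Pk) (least′ _ Pm)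

  sum-<⇒ : ∀ {s u l} → s + u < l → u < l - s
  sum-<⇒ {s} {u} {l} s+u<l = by-< (<⇒0< s+u<l) (regroup s u l)
    where
    regroup : ∀ s u l → l - s - u ≡ l - (s + u)
    regroup = solve-∀ ring

  sum-<⇐ : ∀ {s u l} → u < l - s → s + u < l
  sum-<⇐ {s} {u} {l} u<l-s = by-< (<⇒0< u<l-s) (regroup s u l)
    where
    regroup : ∀ s u l → l - (s + u) ≡ l - s - u
    regroup = solve-∀ ring

  module Greedy (lam : ℚ) (b : ℕ → ℕ) (greedy : IsGreedy lam b) where

    open IsGreedy greedy

    R = remainder lam b

    2≤b : ∀ n → 2 ℕ.≤ b n
    2≤b zero    = proj₁ (proj₁ first)
    2≤b (suc n) = ℕ.≤-trans (2≤b n) (ℕ.<⇒≤ (proj₁ (proj₁ (next n))))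

    0<b : ∀ n → 0 ℕ.< b n
    0<b n = ℕ.≤-trans ℕ.z<s (2≤b n)

    -- For a remainder `p / q` a denominator `x > b n` is admissible exactly if `q < p * x`, and `B`
    -- attains the smallest possible value `q + 1` of `p * x`.
    next-denominator : ∀ n {p q B} → 0 ℕ.< q → ι q * R (suc n) ≡ ι p →
      p ℕ.* B ≡ suc q → b n ℕ.< B → b (suc n) ≡ B
    next-denominator n {p} {q} {B} 0<q qR≡p pB≡q+1 b<B = IsLeast-unique (next n)
      (b<B , sum-<⇐ (unitFraction-< p q (ℕ.≤-trans (0<b n) (ℕ.<⇒≤ b<B)) 0<q qR≡p (ℕ.≤-reflexive (sym pB≡q+1))))
      λ j (b<j , sum<lam) → ℕ.*-cancelˡ-≤ p {{p≢0}} (ℕ.≤-trans (ℕ.≤-reflexive pB≡q+1)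
        (unitFraction-<⁻¹ p q (ℕ.≤-trans (0<b n) (ℕ.<⇒≤ b<j)) 0<q qR≡p (sum-<⇒ sum<lam)))
      where
      p≢0 : ℕ.NonZero p
      p≢0 = ℕ.m*n≢0⇒m≢0 p {{subst ℕ.NonZero (sym pB≡q+1) _}}

    remainder-next : ∀ n {p q l} → ι q * R n ≡ ι p → p ℕ.* b n ≡ q ℕ.+ l → ι (q ℕ.* b n) * R (suc n) ≡ ι l
    remainder-next n {p} {q} {l} qR≡p pb≡q+l = begin
      ι (q ℕ.* b n) * R (suc n)                            ≡⟨ cong₂ _*_ (ι-* q (b n)) (remainder-suc lam b n) ⟩
      ι q * ι (b n) * (R n - unitFraction (b n))           ≡⟨ expand (ι q) (ι (b n)) (R n) (unitFraction (b n)) ⟩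
      ι q * R n * ι (b n) - ι q * (unitFraction (b n) * ι (b n))
        ≡⟨ cong₂ (λ x y → x * ι (b n) - ι q * y) qR≡p (unitFraction-* (0<b n)) ⟩
      ι p * ι (b n) - ι q * 1ℚ
        ≡⟨ cong₂ _-_ (trans (sym (ι-* p (b n))) (trans (cong ι pb≡q+l) (ι-+ q l))) (*-identityʳ (ι q)) ⟩
      ι q + ι l - ι q                                      ≡⟨ cancel (ι q) (ι l) ⟩
      ι l                                                  ∎
      where
      open ≡-Reasoning
      expand : ∀ q b r u → q * b * (r - u) ≡ q * r * b - q * (u * b)
      expand = solve-∀ ring
      cancel : ∀ x y → x + y - x ≡ y
      cancel = solve-∀ ring

    -- The remainder after n terms is p / q, and that after one more term is
    -- l / (q * b n).
    record State (n : ℕ) : Set where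
      field
        p q l : ℕ
        0<p : 0 ℕ.< p
        0<q : 0 ℕ.< q
        0<l : 0 ℕ.< l
        qR≡p : ι q * R n ≡ ι p
        pb≡q+l : p ℕ.* b n ≡ q ℕ.+ l
        -- Hence the remainder after `n + 2` terms is the reciprocal of `q * b n * b (suc n)`.
        lb≡qb+1 : l ℕ.* b (suc n) ≡ suc (q ℕ.* b n)
        -- The right side is twice `l * b (suc n)`, so for integers this amounts to
        -- `b n < b (suc n)`; the form is the one that `W₀-small` requires.
        small-l : l ℕ.* (b n ℕ.+ b n ℕ.+ 1) ℕ.< q ℕ.* b n ℕ.+ q ℕ.* b n ℕ.+ 2

      0<qb : 0 ℕ.< q ℕ.* b n
      0<qb = ℕ.*-mono-< 0<q (0<b n)

      qbR≡l : ι (q ℕ.* b n) * R (suc n) ≡ ι l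
      qbR≡l = remainder-next n qR≡p pb≡q+l

      lb≡qb+1′ : l ℕ.* b (suc n) ≡ q ℕ.* b n ℕ.+ 1
      lb≡qb+1′ = trans lb≡qb+1 (ℕ.+-comm 1 _)

      0<qbb : 0 ℕ.< q ℕ.* b n ℕ.* b (suc n)
      0<qbb = ℕ.*-mono-< 0<qb (0<b (suc n))

      third-denominator : b (suc (suc n)) ≡ suc (q ℕ.* b n ℕ.* b (suc n))
      third-denominator = next-denominator (suc n) {1} 0<qbb
        (remainder-next (suc n) qbR≡l lb≡qb+1′)
        (ℕ.*-identityˡ _) (ℕ.s≤s (ℕ.m≤n*m (b (suc n)) (q ℕ.* b n) {{ℕ.>-nonZero 0<qb}}))

    -- The old `l` becomes the numerator, and the new `l` is 1 in any case because the remainder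
    -- after `n + 2` terms is a reciprocal. Thus only the initial state depends on the case of the
    -- hypothesis.
    next-state : ∀ {n} → State n → State (suc n)
    next-state {n} s = record
      { p = l ; q = q ℕ.* b n ; l = 1 ; 0<p = 0<l ; 0<q = 0<qb ; 0<l = ℕ.z<s
      ; qR≡p = qbR≡l ; pb≡q+l = lb≡qb+1′
      ; lb≡qb+1 = trans (ℕ.*-identityˡ _) third-denominator
      ; small-l = ℕ.≤-<-trans (ℕ.≤-reflexive (ℕ.*-identityˡ _))
          (ℕ.+-mono-≤-< (ℕ.+-mono-≤ b≤qb b≤qb) (ℕ.n<1+n 1))
      }
      where
      open State s
      b≤qb : b (suc n) ℕ.≤ q ℕ.* b n ℕ.* b (suc n)
      b≤qb = ℕ.m≤n*m (b (suc n)) (q ℕ.* b n) {{ℕ.>-nonZero 0<qb}}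

    -- Convergence of the roots of the greedy denominators

    module _ (state₀ : State 0) where

      state : ∀ n → State n
      state zero    = state₀
      state (suc n) = next-state (state n)

      -- The reciprocal of the remainder after n + 2 terms.
      D : ℕ → ℕ
      D n = let open State (state n) in q ℕ.* b n ℕ.* b (suc n)

      b≡1+D : ∀ n → b (2 ℕ.+ n) ≡ suc (D n)
      b≡1+D n = State.third-denominator (state n)

      ι-b : ∀ n → ι (b (2 ℕ.+ n)) ≡ ι (D n) + 1ℚ
      ι-b n = trans (cong ι (b≡1+D n)) (ι-suc′ (D n))

      D-sylvester : ∀ k m → ι (D (m ℕ.+ k)) ≡ sylvester (ι (D k)) m
      D-sylvester k zero    = refl
      D-sylvester k (suc m) = trans (ι-* (D (m ℕ.+ k)) (b (2 ℕ.+ (m ℕ.+ k))))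
        (trans (cong (ι (D (m ℕ.+ k)) *_) (ι-b (m ℕ.+ k))) (cong (λ s → s * (s + 1ℚ)) (D-sylvester k m)))

      1<D : ∀ n → 1 ℕ.< D n
      1<D n = ℕ.≤-trans (2≤b (suc n)) (ℕ.m≤n*m (b (suc n)) (State.q (state n) ℕ.* b n)
        {{ℕ.>-nonZero (State.0<qb (state n))}})

      -- The roots of `D n` increase. The exponent is that of `b (2 + n) = D n + 1`, which is term
      -- number `n + 3` when counting from 1.
      limit : ℝ̄
      limit = sup λ n → D n ^2^- (n ℕ.+ 3)

      ≡sylvester : ∀ n → ι (D n) ≡ sylvester (ι (D 0)) n
      ≡sylvester n = trans (cong (λ m → ι (D m)) (sym (ℕ.+-identityʳ n))) (D-sylvester 0 n)

      limit∌ : ∀ n {r} → 0ℚ ≤ r → ι (b (2 ℕ.+ n)) ≤ r ^ (2 ℕ.^ (n ℕ.+ 3)) → ¬ limit ∋ r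
      limit∌ n 0≤r b≤rᴹ (m , inj₁ r<0) = <-irrefl refl (<-≤-trans r<0 0≤r)
      limit∌ n {r} 0≤r b≤rᴹ (m , inj₂ rᴹ<D) = sylvester-separates 3 (0<ι (ℕ.<-trans ℕ.z<s (1<D 0))) 0≤r m n
        (subst (r ^ (2 ℕ.^ (m ℕ.+ 3)) <_) (trans (sym (ι≡/1 (D m))) (≡sylvester m)) rᴹ<D)
        (subst (_≤ r ^ (2 ℕ.^ (n ℕ.+ 3))) (trans (ι-b n) (cong (_+ 1ℚ) (≡sylvester n))) b≤rᴹ)

      n≤2^n+3 : ∀ n → n ℕ.≤ 2 ℕ.^ (n ℕ.+ 3)
      n≤2^n+3 zero    = ℕ.z≤n
      n≤2^n+3 (suc n) = ℕ.≤-trans (ℕ.≤-reflexive (ℕ.+-comm 1 n))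
        (ℕ.+-mono-≤ (n≤2^n+3 n) (ℕ.≤-trans (ℕ.m^n>0 2 (n ℕ.+ 3)) (ℕ.m≤m+n _ 0)))

      exponent : ∀ n x → x ^ (2 ℕ.^ suc (2 ℕ.+ n)) ≡ x ^ (2 ℕ.^ (n ℕ.+ 3))
      exponent n x = cong (λ k → x ^ (2 ℕ.^ k)) (ℕ.+-comm 3 n)

      limit∋ : ∀ n {r} → r < 0ℚ ⊎ r ^ (2 ℕ.^ (n ℕ.+ 3)) < ι (D n) → limit ∋ r
      limit∋ n (inj₁ r<0)  = n , inj₁ r<0
      limit∋ n {r} (inj₂ rᴹ<D) = n , inj₂ (subst (r ^ (2 ℕ.^ (n ℕ.+ 3)) <_) (ι≡/1 (D n)) rᴹ<D)

      root∋ : ∀ n {r} → r < 0ℚ ⊎ r ^ (2 ℕ.^ (n ℕ.+ 3)) < ι (D n) → roots b (2 ℕ.+ n) ∋ r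
      root∋ n (inj₁ r<0)  = inj₁ r<0
      root∋ n {r} (inj₂ rᴹ<D) = inj₂ (subst₂ _<_ (sym (exponent n r)) (ι≡/1 (b (2 ℕ.+ n)))
        (<-trans rᴹ<D (ι-mono-< (ℕ.≤-reflexive (sym (b≡1+D n))))))

      root∌ : ∀ n {r} → 0ℚ ≤ r → ι (b (2 ℕ.+ n)) ≤ r ^ (2 ℕ.^ (n ℕ.+ 3)) → ¬ roots b (2 ℕ.+ n) ∋ r
      root∌ n 0≤r b≤rᴹ (inj₁ r<0) = <-irrefl refl (<-≤-trans r<0 0≤r)
      root∌ n {r} 0≤r b≤rᴹ (inj₂ rᴹ<b) = <-irrefl refl (<-≤-trans
        (subst₂ _<_ (exponent n r) (sym (ι≡/1 (b (2 ℕ.+ n)))) rᴹ<b) b≤rᴹ)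

      -- The limit and the root of `b (2 + n)` both lie between the roots of `D n` and `D n + 1`.
      -- The `r` of `root-within` therefore witnesses both inequalities.
      near-limit : ∀ n {δ} → 0ℚ < δ → 1ℚ ≤ ι (2 ℕ.^ (n ℕ.+ 3)) * δ →
        (limit <ᵣ roots b (2 ℕ.+ n) +ᵣ (δ + δ)) × (roots b (2 ℕ.+ n) <ᵣ limit +ᵣ (δ + δ))
      near-limit n {δ} 0<δ 1≤Mδ =
        let r , 0≤r , D+1≤rᴹ , r-2δ = root-within (2 ℕ.^ (n ℕ.+ 3)) {{ℕ.m^n≢0 2 (n ℕ.+ 3)}}
              (1<ι (1<D n)) 0<δ 1≤Mδ
            b≤rᴹ = ≤-trans (≤-reflexive (ι-b n)) D+1≤rᴹ
        in (r , root∋ n r-2δ , limit∌ n 0≤r b≤rᴹ) , (r , limit∋ n r-2δ , root∌ n 0≤r b≤rᴹ)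

      converges : roots b ⟶ limit
      converges ε 0<ε = 2 ℕ.+ n₀ , close
        where
        δ = ½ * ε
        0<δ : 0ℚ < δ
        0<δ = 0<* (positive⁻¹ ½) 0<ε
        halves : ∀ ε → ½ * ε + ½ * ε ≡ ε
        halves = solve-∀ ring
        large = archimedean-* 1ℚ 0<δ
        n₀ = proj₁ large

        close : ∀ n → 2 ℕ.+ n₀ ℕ.≤ n → (limit <ᵣ roots b n +ᵣ ε) × (roots b n <ᵣ limit +ᵣ ε)
        close (suc (suc n)) (ℕ.s≤s (ℕ.s≤s n₀≤n)) =
          subst (λ e → (limit <ᵣ roots b (2 ℕ.+ n) +ᵣ e) × (roots b (2 ℕ.+ n) <ᵣ limit +ᵣ e)) (halves ε)
            (near-limit n 0<δ (proj₂ large (2 ℕ.^ (n ℕ.+ 3)) (ℕ.≤-trans n₀≤n (n≤2^n+3 n))))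

  -- A series that differs from the greedy one

  module Competitor
    (lam : ℚ) (b : ℕ → ℕ) (greedy : IsGreedy lam b) (state₀ : Greedy.State lam b greedy 0)
    (a : ℕ → ℕ) (2≤a₀ : 2 ℕ.≤ a 0) (a-mono : ∀ n → a n ℕ.< a (suc n)) (sum : HasSum a lam)
    (k : ℕ) (same : ∀ i → i ℕ.< k → a i ≡ b i) (a≢b : a k ≢ b k)
    where

    open Greedy lam b greedy
    open IsGreedy greedy

    2≤a : ∀ n → 2 ℕ.≤ a n
    2≤a zero    = 2≤a₀
    2≤a (suc n) = ℕ.≤-trans (2≤a n) (ℕ.<⇒≤ (a-mono n))

    0<a : ∀ n → 0 ℕ.< a n
    0<a n = ℕ.≤-trans ℕ.z<s (2≤a n)

    A : ℕ → ℚ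
    A = remainder lam a

    0<A : ∀ n → 0ℚ < A n
    0<A = remainder-pos 0<a sum

    A-step : ∀ n → ι (a n) * (A n - A (suc n)) ≡ 1ℚ
    A-step n = remainder-step lam a n (0<a n)

    admissible : ∀ n → partialSum a n + unitFraction (a n) < lam
    admissible n = by-< (0<A (suc n)) refl

    -- All remainders of `a` are positive, so after a common beginning `a k` is among the
    -- denominators from which the greedy choice takes the least.
    b≤a : ∀ k → (∀ i → i ℕ.< k → a i ≡ b i) → b k ℕ.≤ a k
    b≤a zero    _    = proj₂ first (a 0) (2≤a₀ , subst (_< lam) (+-identityˡ (unitFraction (a 0))) (admissible 0))
    b≤a (suc j) same = proj₂ (next j) (a (suc j))
      ( subst (ℕ._< a (suc j)) (same j ℕ.≤-refl) (a-mono j)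
      , subst (λ s → s + unitFraction (a (suc j)) < lam) (partialSum-cong (suc j) same) (admissible (suc j)))

    b<a : b k ℕ.< a k
    b<a = ℕ.≤∧≢⇒< (b≤a k same) (λ e → a≢b (sym e))

    open State (state state₀ k)

    qA≡p : ι q * A k ≡ ι p
    qA≡p = trans (cong (λ s → ι q * (lam - s)) (partialSum-cong k same)) qR≡p

    small-lℚ : ι l * (ι (b k) + ι (b k) + 1ℚ) < ι q * ι (b k) + ι q * ι (b k) + (1ℚ + 1ℚ)
    small-lℚ = subst₂ _<_ left right (ι-mono-< small-l)
      where
      left : ι (l ℕ.* (b k ℕ.+ b k ℕ.+ 1)) ≡ ι l * (ι (b k) + ι (b k) + 1ℚ)
      left = trans (ι-* l _) (cong (ι l *_) (trans (ι-+ (b k ℕ.+ b k) 1) (cong₂ _+_ (ι-+ (b k) (b k)) ι1≡1)))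
      right : ι (q ℕ.* b k ℕ.+ q ℕ.* b k ℕ.+ 2) ≡ ι q * ι (b k) + ι q * ι (b k) + (1ℚ + 1ℚ)
      right = trans (ι-+ (q ℕ.* b k ℕ.+ q ℕ.* b k) 2) (cong₂ _+_
        (trans (ι-+ (q ℕ.* b k) (q ℕ.* b k)) (cong₂ _+_ (ι-* q (b k)) (ι-* q (b k))))
        (trans (ι-+ 1 1) (cong₂ _+_ ι1≡1 ι1≡1)))

    -- The tail starts at the first difference `k`, where both series have the remainder `p / q` and
    -- `a k` is at least `b k + 1`.
    open Tail (λ i → ι (a (i ℕ.+ k))) (λ i → A (i ℕ.+ k)) (ι p) (ι q) (ι l) (ι (b k))
      (0<ι 0<p) (0<ι 0<q) (0<ι 0<l) (0<ι (0<b k))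
      (λ n → ι-mono-≤ (ℕ.<⇒≤ (a-mono (n ℕ.+ k))))
      (λ n → A-step (n ℕ.+ k))
      qA≡p
      (integrality (λ i → a (i ℕ.+ k)) (λ i → A (i ℕ.+ k)) p q 0<q
        (λ n → 0<a (n ℕ.+ k)) (λ n → 0<A (n ℕ.+ k))
        (λ n → A-step (n ℕ.+ k)) qA≡p)
      (trans (sym (ι-* p (b k))) (trans (cong ι pb≡q+l) (ι-+ q l)))
      (subst (_≤ ι (a k)) (ι-suc′ (b k)) (ι-mono-≤ b<a))
      small-lℚ
      using (W₀; 0<W₀; W; 0<W; W₀-small; remainder-bound)

    W₀<D : W₀ < ι (D state₀ k)
    W₀<D = cancelˡ-< (ι l) (0<ι 0<l) (subst (ι l * W₀ <_) eq W₀-small)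
      where
      regroup : ∀ x l b → x * (l * b) ≡ l * (x * b)
      regroup = solve-∀ ring
      qb = q ℕ.* b k
      eq : ι q * ι (b k) * (ι q * ι (b k) + 1ℚ) ≡ ι l * ι (D state₀ k)
      eq = begin
        ι q * ι (b k) * (ι q * ι (b k) + 1ℚ)   ≡⟨ cong (λ x → x * (x + 1ℚ)) (sym (ι-* q (b k))) ⟩
        ι qb * (ι qb + 1ℚ)
          ≡⟨ cong (ι qb *_) (trans (sym (ι-suc′ qb)) (trans (cong ι (sym lb≡qb+1)) (ι-* l (b (suc k))))) ⟩
        ι qb * (ι l * ι (b (suc k)))           ≡⟨ regroup (ι qb) (ι l) (ι (b (suc k))) ⟩
        ι l * (ι qb * ι (b (suc k)))           ≡⟨ cong (ι l *_) (sym (ι-* qb (b (suc k)))) ⟩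
        ι l * ι (qb ℕ.* b (suc k))             ∎
        where open ≡-Reasoning

    -- A gap larger than 1 makes room for a rational `c` whose power lies between `W m + 1` and `D`.
    separation : ∃[ m ] W m + 1ℚ < ι (D state₀ (m ℕ.+ k))
    separation = let m , gap = sylvester-gap 0<W₀ W₀<D (<⇒≤ (1<ι (1<D state₀ k))) in
      m , subst (W m + 1ℚ <_) (sym (D-sylvester state₀ k m)) gap

    -- If `c` were below the lower limit, some `s > c` would satisfy `s ^ (2 ^ suc i) ≤ a i` from an
    -- index `N` on. Then `A n` is at most `1 / (h - 1)` and, by `remainder-bound`, at least
    -- `1 / W j`; so `h ≤ W j + 1`, which is at most a power of `c` smaller than `h`.
    liminf∌ : ∀ m {c} → 1ℚ ≤ c → W m + 1ℚ ≤ c ^ (2 ℕ.^ (m ℕ.+ k ℕ.+ 3)) → ¬ liminf (roots a) ∋ c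
    liminf∌ m {c} 1≤c W+1≤cᴹ (N , s , c<s , all) = <-irrefl refl (<-≤-trans (≤-<-trans W+1≤cʰ cʰ<sʰ) h≤W+1)
      where
      1<s : 1ℚ < s
      1<s = ≤-<-trans 1≤c c<s
      -- Adding `N` ensures `n ≥ N`. The offset 2 in `n` is that of `remainder-bound`, where `W`
      -- starts two terms after `k`.
      j = N ℕ.+ m
      n = 2 ℕ.+ (j ℕ.+ k)

      below : ∀ i → roots a i ∋ s → s ^ (2 ℕ.^ suc i) ≤ ι (a i)
      below i (inj₁ s<0)  = contradiction (<-trans (<-trans 0<1 1<s) s<0) (<-irrefl refl)
      below i (inj₂ sᴹ<a) = ≤-trans (<⇒≤ sᴹ<a) (≤-reflexive (sym (ι≡/1 (a i))))

      fast : ∀ i → N ℕ.≤ i → s ^ (2 ℕ.^ suc i) ≤ ι (a i)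
      fast i N≤i = below i (subst (λ i → roots a i ∋ s) (ℕ.m+[n∸m]≡n N≤i) (all (i ℕ.∸ N)))

      h = s ^ (2 ℕ.^ suc n)

      h-1≤W : h - 1ℚ ≤ W j
      h-1≤W = cancelˡ-≤ (A n) (0<A n) (≤-trans
        (remainder-of-fast-series (λ i → ι (a i)) A A-step (remainder→0 sum) 1<s N fast n N≤n)
        (≤-trans (remainder-bound j) (≤-reflexive (*-comm (W j) (A n)))))
        where
        N≤n : N ℕ.≤ n
        N≤n = ℕ.≤-trans (ℕ.m≤m+n N m) (ℕ.≤-trans (ℕ.m≤m+n j k) (ℕ.m≤n+m (j ℕ.+ k) 2))

      h≤W+1 : h ≤ W j + 1ℚ
      h≤W+1 = subst (_≤ W j + 1ℚ) (restore h) (+-monoˡ-≤ 1ℚ h-1≤W)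
        where
        restore : ∀ h → h - 1ℚ + 1ℚ ≡ h
        restore = solve-∀ ring

      W+1≤cʰ : W j + 1ℚ ≤ c ^ (2 ℕ.^ suc n)
      W+1≤cʰ = subst₂ (λ w e → w + 1ℚ ≤ c ^ (2 ℕ.^ e)) (sylvester-+ W₀ N m) (exponents N m k)
        (sylvester-+1 (m ℕ.+ k ℕ.+ 3) (0<W m) W+1≤cᴹ N)
        where
        exponents : ∀ N m k → N ℕ.+ (m ℕ.+ k ℕ.+ 3) ≡ 3 ℕ.+ (N ℕ.+ m ℕ.+ k)
        exponents = ℕ-solve-∀

      cʰ<sʰ : c ^ (2 ℕ.^ suc n) < h
      cʰ<sʰ = ^-mono-< (2 ℕ.^ suc n) {{ℕ.m^n≢0 2 (suc n)}} 1≤c c<s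

    strict : liminf (roots a) <ᵣ limit state₀
    strict =
      let m , gap = separation
          c , 1≤c , W+1≤cᴹ , cᴹ<D = powers-dense (2 ℕ.^ (m ℕ.+ k ℕ.+ 3)) {{ℕ.m^n≢0 2 (m ℕ.+ k ℕ.+ 3)}}
            (+-monoˡ-≤ 1ℚ (<⇒≤ (0<W m))) gap
      in c , limit∋ state₀ (m ℕ.+ k) (inj₂ cᴹ<D) , liminf∌ m 1≤c W+1≤cᴹ

  -- The first two greedy denominators in the two cases of the hypothesis

  module InitialState
    (p q : ℕ) .{{_ : ℕ.NonZero p}} .{{_ : ℕ.NonZero q}} (p/q≤1 : (ℤ.+ p / q) ≤ 1ℚ)
    (b : ℕ → ℕ) (greedy : IsGreedy (ℤ.+ p / q) b)
    where

    open Greedy (ℤ.+ p / q) b greedy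

    q*p/q≡p : ι q * (ℤ.+ p / q) ≡ ι p
    q*p/q≡p = trans (*-comm (ι q) (ℤ.+ p / q)) (/-* p q)

    p≤q : p ℕ.≤ q
    p≤q = ι-cancel-≤ (subst₂ _≤_ (/-* p q) (*-identityˡ (ι q)) (*-monoʳ (0≤ι q) p/q≤1))

    0<q : 0 ℕ.< q
    0<q = ℕ.>-nonZero⁻¹ q

    initial : ∀ {l B B′} → 0 ℕ.< l → p ℕ.* B ≡ q ℕ.+ l → (∀ k → q ℕ.< p ℕ.* k → B ℕ.≤ k) →
      l ℕ.* B′ ≡ suc (q ℕ.* B) → l ℕ.* (B ℕ.+ B ℕ.+ 1) ℕ.< q ℕ.* B ℕ.+ q ℕ.* B ℕ.+ 2 → State 0
    initial {l} {B} {B′} 0<l pB≡q+l B-least lB′≡qB+1 small-l = record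
      { p = p ; q = q ; l = l ; 0<p = ℕ.>-nonZero⁻¹ p ; 0<q = 0<q ; 0<l = 0<l
      ; qR≡p = qR≡p ; pb≡q+l = pb≡q+l
      ; lb≡qb+1 = trans (cong (l ℕ.*_) b₁≡B′) lB′≡qb+1
      ; small-l = subst (λ B → l ℕ.* (B ℕ.+ B ℕ.+ 1) ℕ.< q ℕ.* B ℕ.+ q ℕ.* B ℕ.+ 2) (sym b₀≡B) small-l
      }
      where
      2≤B : 2 ℕ.≤ B
      2≤B = ℕ.≰⇒> λ B≤1 → ℕ.<-irrefl refl (ℕ.<-≤-trans (ℕ.m<m+n q 0<l)
        (ℕ.≤-trans (ℕ.≤-reflexive (sym pB≡q+l))
          (ℕ.≤-trans (ℕ.*-monoʳ-≤ p B≤1) (ℕ.≤-trans (ℕ.≤-reflexive (ℕ.*-identityʳ p)) p≤q))))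

      b₀≡B : b 0 ≡ B
      b₀≡B = IsLeast-unique (IsGreedy.first greedy)
        (2≤B , unitFraction-< p q (ℕ.≤-trans ℕ.z<s 2≤B) 0<q q*p/q≡p
          (subst (q ℕ.<_) (sym pB≡q+l) (ℕ.m<m+n q 0<l)))
        λ k (2≤k , u<lam) → B-least k (unitFraction-<⁻¹ p q (ℕ.≤-trans ℕ.z<s 2≤k) 0<q q*p/q≡p u<lam)

      qR≡p : ι q * R 0 ≡ ι p
      qR≡p = trans (cong (ι q *_) (+-identityʳ (ℤ.+ p / q))) q*p/q≡p

      pb≡q+l : p ℕ.* b 0 ≡ q ℕ.+ l
      pb≡q+l = trans (cong (p ℕ.*_) b₀≡B) pB≡q+l

      lB′≡qb+1 : l ℕ.* B′ ≡ suc (q ℕ.* b 0)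
      lB′≡qb+1 = trans lB′≡qB+1 (cong (λ B → suc (q ℕ.* B)) (sym b₀≡B))

      -- The right side of `small-l` is `2 * l * B′`, which would be at most `2 * l * B` if
      -- `B′ ≤ B`.
      B<B′ : B ℕ.< B′
      B<B′ = ℕ.≰⇒> λ B′≤B → ℕ.<-irrefl refl (ℕ.<-≤-trans small-l (ℕ.≤-trans
        (ℕ.≤-reflexive (trans (regroup (q ℕ.* B)) (trans (cong (2 ℕ.*_) (sym lB′≡qB+1)) (regroup′ l B′))))
        (ℕ.*-monoʳ-≤ l (ℕ.≤-trans (ℕ.+-mono-≤ B′≤B B′≤B) (ℕ.m≤m+n _ 1)))))
        where
        regroup : ∀ x → x ℕ.+ x ℕ.+ 2 ≡ 2 ℕ.* suc x
        regroup = ℕ-solve-∀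
        regroup′ : ∀ l B → 2 ℕ.* (l ℕ.* B) ≡ l ℕ.* (B ℕ.+ B)
        regroup′ = ℕ-solve-∀

      b₁≡B′ : b 1 ≡ B′
      b₁≡B′ = next-denominator 0 {l} (ℕ.*-mono-< 0<q (0<b 0)) (remainder-next 0 qR≡p pb≡q+l) lB′≡qb+1
        (subst (ℕ._< B′) (sym b₀≡B) B<B′)

    state-i : p ℕ.∣ q ℕ.+ 1 → State 0
    state-i (ℕ.divides B q+1≡Bp) = initial {1} {B} {suc (q ℕ.* B)} ℕ.z<s pB≡q+1
      (λ k q<pk → ℕ.*-cancelˡ-≤ p (ℕ.≤-trans (ℕ.≤-reflexive (trans pB≡q+1 (ℕ.+-comm q 1))) q<pk))
      (ℕ.*-identityˡ _)
      (ℕ.≤-<-trans (ℕ.≤-reflexive (ℕ.*-identityˡ _)) (ℕ.+-mono-≤-< (ℕ.+-mono-≤ B≤qB B≤qB) (ℕ.n<1+n 1)))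
      where
      pB≡q+1 = trans (ℕ.*-comm p B) (sym q+1≡Bp)
      B≤qB = ℕ.m≤n*m B q

    even⊎odd : ∀ n → (2 ℕ.∣ n) ⊎ (2 ℕ.∣ suc n)
    even⊎odd zero    = inj₁ (ℕ.divides 0 refl)
    even⊎odd (suc n) = [ (λ 2∣n → inj₂ (ℕ.∣m∣n⇒∣m+n ℕ.∣-refl 2∣n)) , inj₁ ]′ (even⊎odd n)

    odd : ∀ {n} → 2 ℕ.∤ n → 2 ℕ.∣ suc n
    odd {n} 2∤n = [ (λ 2∣n → contradiction 2∣n 2∤n) , (λ 2∣1+n → 2∣1+n) ]′ (even⊎odd n)

    -- As `p` does not divide `q + 1`, the least multiple of `p` above `q` is `p * B = q + 2`. It is
    -- odd, so `B` is odd and `(q * B + 1) / 2` is an integer. Moreover `q` is odd and not 1, since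
    -- `q = 1` would force `p = 1`; thus `q ≥ 3`, which gives `small-l`.
    state-ii : 2 ℕ.∤ q → IsLeast (λ ℓ → (1 ℕ.≤ ℓ) × (p ℕ.∣ q ℕ.+ ℓ)) 2 → State 0
    state-ii 2∤q ((_ , ℕ.divides B q+2≡Bp) , least) = initial {2} {B} {ℕ.quotient 2∣qB+1} ℕ.z<s pB≡q+2
      (λ k q<pk → ℕ.*-cancelˡ-≤ p (ℕ.≤-trans (ℕ.≤-reflexive (trans pB≡q+2 (ℕ.+-comm q 2)))
        (ℕ.≤∧≢⇒< q<pk λ 1+q≡pk → p∤q+1 (ℕ.divides k (trans (ℕ.+-comm q 1) (trans 1+q≡pk (ℕ.*-comm p k)))))))
      (trans (ℕ.*-comm 2 (ℕ.quotient 2∣qB+1)) (sym (ℕ._∣_.equality 2∣qB+1)))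
      (ℕ.<-≤-trans (ℕ.<-≤-trans (ℕ.m<m+n (2 ℕ.* (B ℕ.+ B ℕ.+ 1)) (ℕ.≤-trans 0<B (ℕ.m≤m+n B B)))
          (ℕ.≤-reflexive (regroup B)))
        (ℕ.+-monoˡ-≤ 2 (ℕ.+-mono-≤ (ℕ.*-monoˡ-≤ B 3≤q) (ℕ.*-monoˡ-≤ B 3≤q))))
      where
      pB≡q+2 : p ℕ.* B ≡ q ℕ.+ 2
      pB≡q+2 = trans (ℕ.*-comm p B) (sym q+2≡Bp)

      p∤q+1 : p ℕ.∤ q ℕ.+ 1
      p∤q+1 p∣q+1 = contradiction (least 1 (ℕ.≤-refl , p∣q+1)) (ℕ.<⇒≱ (ℕ.n<1+n 1))

      q≢1 : q ≢ 1
      q≢1 q≡1 = p∤q+1 (subst (ℕ._∣ q ℕ.+ 1)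
        (ℕ.≤-antisym (ℕ.>-nonZero⁻¹ p) (subst (p ℕ.≤_) q≡1 p≤q)) (ℕ.1∣ (q ℕ.+ 1)))

      3≤q : 3 ℕ.≤ q
      3≤q = ℕ.≤∧≢⇒< (ℕ.≤∧≢⇒< 0<q (λ 1≡q → q≢1 (sym 1≡q))) λ 2≡q → 2∤q (subst (2 ℕ.∣_) 2≡q ℕ.∣-refl)

      2∤B : 2 ℕ.∤ B
      2∤B 2∣B = 2∤q (ℕ.∣m+n∣m⇒∣n (subst (2 ℕ.∣_) (trans pB≡q+2 (ℕ.+-comm q 2)) (ℕ.∣n⇒∣m*n p 2∣B)) ℕ.∣-refl)

      0<B : 0 ℕ.< B
      0<B = ℕ.n≢0⇒n>0 λ B≡0 → 2∤B (subst (2 ℕ.∣_) (sym B≡0) (ℕ.divides 0 refl))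

      -- Parity of `q * B + 1`: it differs by the even number `2 * B` from a sum of multiples of the
      -- even numbers `q + 1` and `B + 1`.
      expand : ∀ q B → suc q ℕ.* B ℕ.+ suc B ≡ 2 ℕ.* B ℕ.+ suc (q ℕ.* B)
      expand = ℕ-solve-∀

      2∣qB+1 : 2 ℕ.∣ suc (q ℕ.* B)
      2∣qB+1 = ℕ.∣m+n∣m⇒∣n
        (subst (2 ℕ.∣_) (expand q B) (ℕ.∣m∣n⇒∣m+n (ℕ.∣m⇒∣m*n B (odd 2∤q)) (odd 2∤B)))
        (ℕ.∣m⇒∣m*n B ℕ.∣-refl)

      regroup : ∀ B → 2 ℕ.* (B ℕ.+ B ℕ.+ 1) ℕ.+ (B ℕ.+ B) ≡ 3 ℕ.* B ℕ.+ 3 ℕ.* B ℕ.+ 2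
      regroup = ℕ-solve-∀

    state₀ : (p ℕ.∣ q ℕ.+ 1) ⊎ ((2 ℕ.∤ q) × IsLeast (λ ℓ → (1 ℕ.≤ ℓ) × (p ℕ.∣ q ℕ.+ ℓ)) 2) → State 0
    state₀ (inj₁ p∣q+1)           = state-i p∣q+1
    state₀ (inj₂ (2∤q , 2-least)) = state-ii 2∤q 2-least

  -- The first index at which two sequences differ

  first-difference : ∀ (a b : ℕ → ℕ) n →
    (∀ i → i ℕ.< n → a i ≡ b i) ⊎ ∃[ k ] ((∀ i → i ℕ.< k → a i ≡ b i) × a k ≢ b k)
  first-difference a b zero = inj₁ λ _ ()
  first-difference a b (suc n) with first-difference a b n
  ... | inj₂ found = inj₂ found
  ... | inj₁ same with a n ℕ.≟ b n
  ...   | no a≢b = inj₂ (n , same , a≢b)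
  ...   | yes a≡b = inj₁ λ i i<1+n → [ same i , (λ { refl → a≡b }) ]′ (ℕ.m<1+n⇒m<n∨m≡n i<1+n)

  -- Excluded middle decides whether a first difference exists; if there is none, the bounded search
  -- shows agreement at every index.
  differ : ExcludedMiddle 0ℓ → ∀ (a b : ℕ → ℕ) → ¬ (∀ n → a n ≡ b n) →
    ∃[ k ] ((∀ i → i ℕ.< k → a i ≡ b i) × a k ≢ b k)
  differ em a b a≢b with em {∃[ k ] ((∀ i → i ℕ.< k → a i ≡ b i) × a k ≢ b k)}
  ... | yes found = found
  ... | no none = contradiction
    (λ n → [ (λ same → same n ℕ.≤-refl) , (λ found → contradiction found none) ]′
      (first-difference a b (suc n)))
    a≢b

open import Axiom.ExcludedMiddle using (ExcludedMiddle)
open import Data.Integer using (+_)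
open import Data.Nat using (ℕ; suc; _+_; _≤_; _<_; NonZero)
open import Data.Nat.Coprimality using (Coprime)
open import Data.Nat.Divisibility using (_∣_; _∤_)
open import Data.Product using (_×_; _,_; ∃-syntax)
open import Data.Rational using (_/_; 1ℚ) renaming (_≤_ to _≤ℚ_)
open import Data.Sum using (_⊎_)
open import Level using (0ℓ)
open import Relation.Binary.PropositionalEquality using (_≡_)
open import Relation.Nullary using (¬_)

mainTheorem5 : ExcludedMiddle 0ℓ →
    (p q : ℕ) → .{{_ : NonZero p}} → .{{_ : NonZero q}} →
    Coprime p q → (+ p / q) ≤ℚ 1ℚ →
    (p ∣ q + 1) ⊎ ((2 ∤ q) × IsLeast (λ ℓ → (1 ≤ ℓ) × (p ∣ q + ℓ)) 2) →
    (b : ℕ → ℕ) → IsGreedy (+ p / q) b →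
    ∃[ L ] (roots b ⟶ L) ×
    ((a : ℕ → ℕ) → 2 ≤ a 0 → (∀ n → a n < a (suc n)) →
    HasSum a (+ p / q) → ¬ (∀ n → a n ≡ b n) →
    liminf (roots a) <ᵣ L)
mainTheorem5 em p q _ p/q≤1 hypothesis b greedy =
  limit state₀ , converges state₀ , λ a 2≤a₀ a-mono sum a≢b →
    let k , same , aₖ≢bₖ = differ em a b a≢b
    in Competitor.strict (+ p / q) b greedy state₀ a 2≤a₀ a-mono sum k same aₖ≢bₖ
  where
  open Lemmas
  open Greedy (+ p / q) b greedy
  state₀ = InitialState.state₀ p q p/q≤1 b greedy hypothesis
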